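{- Let $R=(r_1,\dots,r_m)$ and $C=(c_1,\dots,c_n)$ be positive integer vectors with $\sum_{i=1}^m r_i=\sum_{j=1}^n c_j$, and let $X^*=(x^*_{ij})$ be the typical table for the margins $(R,C)$. Let $r_+=\max_i r_i$, $r_-=\min_i r_i$, $c_+=\max_j c_j$, $c_-=\min_j c_j$. (1) We have $$x^*_{ij}\ \ge\ \frac{r_-c_- }{r_+m}\quad\text{and}\quad x^*_{ij}\ \ge\ \frac{c_-r_- }{c_+n}\quad\text{for all } i,j.$$ (2) If $r_-c_++r_-c_-+mr_->r_+c_+$, then $$x^*_{ij}\le\frac{c_+\left(r_-c_-+mr_+\right)}{m\left(r_-c_++r_-c_-+mr_--r_+c_+\right)}\quad\text{for all } i,j.$$ Similarly, if $c_-r_++c_-r_-+nc_->r_+c_+$, then $$x^*_{ij}\le\frac{r_+\left(c_-r_-+nc_+\right)}{n\left(c_-r_++c_-r_-+nc_--c_+r_+\right)}\quad\text{for all } i,j.$$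
   Context: The typical table $X^*=(x^*_{ij})$ for margins $(R,C)$ is the unique maximizer of the strictly concave function $g(X)=\sum_{ij}\left((x_{ij}+1)\ln(x_{ij}+1)-x_{ij}\ln x_{ij}\right)$ (with $0\ln0=0$) on the transportation polytope $\mathcal{P}(R,C)$ of all $m\times n$ non-negative real matrices $X=(x_{ij})$ with row sums $R$ and column sums $C$. -}

module Defs where

open import Algebra.Bundles using (CommutativeRing)
open import Algebra.Core using (Op₁; Op₂)
open import Algebra.Structures using (IsCommutativeRing)
import Algebra.Properties.Semiring.Exp as SemiringExp
import Algebra.Properties.Semiring.Mult as SemiringMult
import Algebra.Properties.Semiring.Sum as SemiringSum
open import Data.Fin.Base using (toℕ)
open import Data.Nat.Base as ℕ using (ℕ; suc; _!)
open import Data.Product.Base using (_×_; ∃-syntax)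
open import Data.Vec.Functional using (Vector; foldr; head; tail)
open import Level using (Level; _⊔_) renaming (suc to lsuc)
import Relation.Binary.Construct.NonStrictToStrict as NonStrictToStrict
open import Relation.Binary.Core using (Rel)
open import Relation.Binary.Definitions using (Decidable)
open import Relation.Binary.Structures using (IsDecTotalOrder)
open import Relation.Nullary using (¬_; yes; no)
open import Relation.Unary using (Pred; Satisfiable)

-- The real numbers, given by their usual (classical) axioms: a Dedekind
-- complete totally ordered field.  Any two such structures are isomorphic.

record CompleteOrderedField (c ℓ₁ ℓ₂ : Level) : Set (lsuc (c ⊔ ℓ₁ ⊔ ℓ₂)) where
  infix  8 -_ _⁻¹
  infixl 7 _*_ _/_
  infixl 6 _+_ _-_
  infix  4 _≈_ _≉_ _≤_

  field
    Carrier           : Set c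
    _≈_               : Rel Carrier ℓ₁
    _≤_               : Rel Carrier ℓ₂
    _+_ _*_           : Op₂ Carrier
    -_ _⁻¹            : Op₁ Carrier
    0# 1#             : Carrier
    isCommutativeRing : IsCommutativeRing _≈_ _+_ _*_ -_ 0# 1#
    isDecTotalOrder   : IsDecTotalOrder _≈_ _≤_

  _≉_ : Rel Carrier ℓ₁
  x ≉ y = ¬ (x ≈ y)

  -- The inverse is a total operation; its value at 0# is left unspecified.
  field
    1≉0        : 1# ≉ 0#
    ⁻¹-cong    : ∀ {x y} → x ≈ y → x ⁻¹ ≈ y ⁻¹
    ⁻¹-inverse : ∀ {x} → x ≉ 0# → x * x ⁻¹ ≈ 1#
    +-monoˡ-≤  : ∀ z {x y} → x ≤ y → x + z ≤ y + z
    *-nonNeg   : ∀ {x y} → 0# ≤ x → 0# ≤ y → 0# ≤ x * y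

  UpperBound : ∀ {p} → Pred Carrier p → Pred Carrier (c ⊔ ℓ₂ ⊔ p)
  UpperBound P b = ∀ x → P x → x ≤ b

  field
    supremum : ∀ (P : Pred Carrier (c ⊔ ℓ₁ ⊔ ℓ₂)) →
               Satisfiable P → Satisfiable (UpperBound P) →
               ∃[ s ] UpperBound P s × (∀ b → UpperBound P b → s ≤ b)

  commutativeRing : CommutativeRing c ℓ₁
  commutativeRing = record { isCommutativeRing = isCommutativeRing }

  open CommutativeRing commutativeRing public using (semiring)
  open SemiringSum semiring public using (sum)
  open SemiringExp semiring public using (_^_)
  open NonStrictToStrict _≈_ _≤_ public using (_<_)

  _<?_ : Decidable _<_
  _<?_ = NonStrictToStrict.<-decidable _≈_ _≤_ _≟_ _≤?_
    where open IsDecTotalOrder isDecTotalOrder using (_≟_; _≤?_)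

  _-_ : Op₂ Carrier
  x - y = x + - y

  _/_ : Op₂ Carrier
  x / y = x * y ⁻¹

  fromℕ : ℕ → Carrier
  fromℕ k = k · 1#
    where open SemiringMult semiring using () renaming (_×_ to _·_)

module _ {c ℓ₁ ℓ₂} (ℝ : CompleteOrderedField c ℓ₁ ℓ₂) where
  open CompleteOrderedField ℝ

  _ConvergesTo_ : (ℕ → Carrier) → Carrier → Set (c ⊔ ℓ₁ ⊔ ℓ₂)
  a ConvergesTo l = ∀ ε → 0# < ε → ∃[ N ] ∀ n → N ℕ.≤ n →
                    (l - ε < a n) × (a n < l + ε)

  expPartialSum : Carrier → ℕ → Carrier
  expPartialSum y n = sum {n} (λ k → y ^ toℕ k / fromℕ (toℕ k !))

  -- z = exp y
  IsExp : Carrier → Carrier → Set (c ⊔ ℓ₁ ⊔ ℓ₂)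
  IsExp y z = expPartialSum y ConvergesTo z

  -- The natural logarithm on the positive reals, the inverse of exp.  There
  -- is exactly one (up to _≈_), since exp is a bijection onto the positives.
  record NaturalLogarithm : Set (c ⊔ ℓ₁ ⊔ ℓ₂) where
    field
      ln      : ∀ x → 0# < x → Carrier
      ln-cong : ∀ {x y} (0<x : 0# < x) (0<y : 0# < y) → x ≈ y →
                ln x 0<x ≈ ln y 0<y
      exp-ln  : ∀ x (0<x : 0# < x) → IsExp (ln x 0<x) x

  Matrix : ℕ → ℕ → Set c
  Matrix m n = Vector (Vector Carrier n) m

  record TransportationPolytope {m n} (R : Vector ℕ m) (C : Vector ℕ n)
                                (X : Matrix m n) : Set (c ⊔ ℓ₁ ⊔ ℓ₂) where
    field
      nonNegative : ∀ i j → 0# ≤ X i j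
      rowSums     : ∀ i → sum (λ j → X i j) ≈ fromℕ (R i)
      columnSums  : ∀ j → sum (λ i → X i j) ≈ fromℕ (C j)

  module _ (log : NaturalLogarithm) where
    open NaturalLogarithm log

    -- x ln x with 0 ln 0 = 0; only used at x ≥ 0.
    xlnx : Op₁ Carrier
    xlnx x with 0# <? x
    ... | yes 0<x = x * ln x 0<x
    ... | no  _   = 0#

    g : ∀ {m n} → Matrix m n → Carrier
    g X = sum (λ i → sum (λ j → xlnx (X i j + 1#) - xlnx (X i j)))

    -- Uniqueness of the maximizer follows from strict concavity of g, so it
    -- is not part of the definition.
    record IsTypicalTable {m n} (R : Vector ℕ m) (C : Vector ℕ n)
                          (X : Matrix m n) : Set (c ⊔ ℓ₁ ⊔ ℓ₂) where
      field
        feasible : TransportationPolytope R C X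
        maximal  : ∀ Y → TransportationPolytope R C Y → g Y ≤ g X

total : ∀ {n} → Vector ℕ n → ℕ
total = foldr ℕ._+_ 0

maximum minimum : ∀ {n} → Vector ℕ (suc n) → ℕ
maximum v = foldr ℕ._⊔_ (head v) (tail v)
minimum v = foldr ℕ._⊓_ (head v) (tail v)

{-# OPTIONS --safe #-}
module Submission where

open import Defs
open import Algebra.Bundles using (CommutativeRing)
import Algebra.Properties.Ring as RingProperties
import Algebra.Properties.Semiring.Mult as SemiringMultiplication
import Algebra.Properties.Semiring.Mult.TCOptimised as SemiringMult
import Algebra.Properties.Semiring.Sum as SemiringSum
import Algebra.Solver.Ring as RingSolver
open import Algebra.Solver.Ring.AlmostCommutativeRing using (fromCommutativeRing; _-Raw-AlmostCommutative⟶_)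
open import Data.Fin.Base using (Fin; zero; suc; toℕ)
import Data.Fin.Properties as Fin
open import Data.Integer.Base as ℤ using (ℤ; +_; -[1+_]; _⊖_; _◃_)
import Data.Integer.Properties as ℤ
open import Data.Maybe.Base using (Maybe; map)
open import Data.Nat.Base as ℕ using (ℕ; zero; suc; z≤n; s≤s; _!)
import Data.Nat.Properties as ℕ
open import Data.Product.Base using (_×_; _,_; proj₁; proj₂; ∃-syntax)
import Data.Sign.Base as Sign
open import Data.Sum.Base using (_⊎_; inj₁; inj₂)
open import Data.Vec.Functional using (Vector; foldr; head; tail)
open import Function.Base using (flip; _∘_)
open import Level using (Lift; lift; _⊔_)
open import Relation.Binary.Bundles using (Poset)
open import Relation.Binary.PropositionalEquality as ≡ using (_≡_; _≢_)
open import Relation.Binary.Structures using (IsDecTotalOrder)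
open import Relation.Nullary using (¬_; Dec; yes; no; contradiction)
open import Relation.Nullary.Decidable using (decidable-stable; dec⇒maybe)

-- Moving mass δ around a 2 × 2 minor keeps a table in the polytope, so
-- maximality of g, by concavity, forces u_ij u_kl = u_il u_kj for
-- u = (x + 1) / x; this also makes all entries positive.  Lower bound: if
-- x_ij is the least entry of its row, then x_ij / x_kj is the largest ratio
-- of rows i and k, hence at least r₋ / r₊, and some x_kj is at least the
-- average c_j / m.  Upper bound on x_kl: choose x_il at most c₊ / m and j
-- with x_kj / x_ij ≤ r₊ / r₋, insert the lower bound for x_ij and solve the
-- minor relation for x_kl.
--
-- Of the logarithm only ln (ab) = ln a + ln b and a (ln b - ln a) ≤ b - a are
-- used.  Both come from exp x · exp y = exp (x + y) for partial sums, where
-- the error is a polynomial in x, y with nonnegative coefficients, hence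
-- bounded by a tail of the series at ∣x∣ + ∣y∣.

-- Zero entries shape the optimality argument. A priori an entry of the typical table may be 0,
-- where the derivative ln((x + 1)/x) of a summand of g is infinite. Tangents are therefore taken at
-- the moved table, whose changed entries are all positive; the resulting condition is cleared of
-- denominators, and only then does δ tend to 0. The limit inequality makes sense for zero entries
-- too and is what excludes them. The row minimum enters the lower bound as follows. By the minor
-- relation ρ = u_ij / u_kj does not depend on j, and solving for the ratio gives x_ij / x_kj = 1/ρ
-- + (1/ρ - 1) x_ij. This is affine in x_ij and nonincreasing when ρ ≥ 1, that is, when x_ij ≤ x_kj.

-- Ring solver with integer coefficients.

module IntegerCoefficients {c ℓ} (R : CommutativeRing c ℓ) where
  open CommutativeRing R
  open RingProperties ring
  open SemiringMult semiring renaming (_×_ to _·_)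
  open import Relation.Binary.Reasoning.Setoid setoid

  -- The optimised multiple makes con (+ 1) evaluate to 1# and not to 1# + 0#.
  fromℤ : ℤ → Carrier
  fromℤ (+ n)    = n · 1#
  fromℤ -[1+ n ] = - (suc n · 1#)

  fromℤ-⊖ : ∀ m n → fromℤ (m ⊖ n) ≈ m · 1# - n · 1#
  fromℤ-⊖ zero    zero    = sym (-‿inverseʳ 0#)
  fromℤ-⊖ zero    (suc n) = sym (+-identityˡ _)
  fromℤ-⊖ (suc m) zero    = sym (trans (+-congˡ -0#≈0#) (+-identityʳ _))
  fromℤ-⊖ (suc m) (suc n) = begin
    fromℤ (suc m ⊖ suc n)                   ≡⟨ ≡.cong fromℤ (ℤ.[1+m]⊖[1+n]≡m⊖n m n) ⟩
    fromℤ (m ⊖ n)                           ≈⟨ fromℤ-⊖ m n ⟩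
    m · 1# - n · 1#                         ≈⟨ +-congʳ (+-identityˡ _) ⟨
    0# + m · 1# - n · 1#                    ≈⟨ +-congʳ (+-congʳ (-‿inverseʳ 1#)) ⟨
    1# - 1# + m · 1# - n · 1#               ≈⟨ +-congʳ (+-assoc _ _ _) ⟩
    1# + (- 1# + m · 1#) - n · 1#           ≈⟨ +-congʳ (+-congˡ (+-comm _ _)) ⟩
    1# + (m · 1# - 1#) - n · 1#             ≈⟨ +-congʳ (+-assoc _ _ _) ⟨
    1# + m · 1# - 1# - n · 1#               ≈⟨ +-assoc _ _ _ ⟩
    1# + m · 1# + (- 1# - n · 1#)           ≈⟨ +-congˡ (-‿+-comm 1# (n · 1#)) ⟩
    1# + m · 1# - (1# + n · 1#)             ≈⟨ +-cong (1+× m 1#) (-‿cong (1+× n 1#)) ⟨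
    suc m · 1# - suc n · 1#                 ∎

  fromℤ-+◃ : ∀ n → fromℤ (Sign.+ ◃ n) ≈ n · 1#
  fromℤ-+◃ zero    = refl
  fromℤ-+◃ (suc n) = refl

  fromℤ--◃ : ∀ n → fromℤ (Sign.- ◃ n) ≈ - (n · 1#)
  fromℤ--◃ zero    = sym -0#≈0#
  fromℤ--◃ (suc n) = refl

  fromℤ-+ : ∀ i j → fromℤ (i ℤ.+ j) ≈ fromℤ i + fromℤ j
  fromℤ-+ (+ m)    (+ n)    = ×-homo-+ 1# m n
  fromℤ-+ (+ m)    -[1+ n ] = fromℤ-⊖ m (suc n)
  fromℤ-+ -[1+ m ] (+ n)    = trans (fromℤ-⊖ n (suc m)) (+-comm _ _)
  fromℤ-+ -[1+ m ] -[1+ n ] = begin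
    - (suc (suc (m ℕ.+ n)) · 1#)           ≡⟨ ≡.cong (λ k → - (k · 1#)) (≡.sym (ℕ.+-suc (suc m) n)) ⟩
    - ((suc m ℕ.+ suc n) · 1#)             ≈⟨ -‿cong (×-homo-+ 1# (suc m) (suc n)) ⟩
    - (suc m · 1# + suc n · 1#)            ≈⟨ sym (-‿+-comm _ _) ⟩
    - (suc m · 1#) - suc n · 1#            ∎
    where import Data.Nat.Properties as ℕ

  fromℤ-* : ∀ i j → fromℤ (i ℤ.* j) ≈ fromℤ i * fromℤ j
  fromℤ-* (+ m)    (+ n)    = trans (fromℤ-+◃ (m ℕ.* n)) (×1-homo-* m n)
  fromℤ-* (+ m)    -[1+ n ] = begin
    fromℤ (Sign.- ◃ m ℕ.* suc n)    ≈⟨ fromℤ--◃ (m ℕ.* suc n) ⟩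
    - ((m ℕ.* suc n) · 1#)          ≈⟨ -‿cong (×1-homo-* m (suc n)) ⟩
    - (m · 1# * (suc n · 1#))       ≈⟨ -‿distribʳ-* _ _ ⟩
    m · 1# * - (suc n · 1#)         ∎
  fromℤ-* -[1+ m ] (+ n)    = begin
    fromℤ (Sign.- ◃ suc m ℕ.* n)    ≈⟨ fromℤ--◃ (suc m ℕ.* n) ⟩
    - ((suc m ℕ.* n) · 1#)          ≈⟨ -‿cong (×1-homo-* (suc m) n) ⟩
    - (suc m · 1# * (n · 1#))       ≈⟨ -‿distribˡ-* _ _ ⟩
    - (suc m · 1#) * (n · 1#)       ∎
  fromℤ-* -[1+ m ] -[1+ n ] = begin
    fromℤ (Sign.+ ◃ suc m ℕ.* suc n)    ≈⟨ fromℤ-+◃ (suc m ℕ.* suc n) ⟩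
    (suc m ℕ.* suc n) · 1#              ≈⟨ ×1-homo-* (suc m) (suc n) ⟩
    suc m · 1# * (suc n · 1#)           ≈⟨ sym (-x*-y≈x*y _ _) ⟩
    - (suc m · 1#) * - (suc n · 1#)     ∎
    where
    -x*-y≈x*y : ∀ x y → - x * - y ≈ x * y
    -x*-y≈x*y x y = begin
      - x * - y     ≈⟨ sym (-‿distribˡ-* _ _) ⟩
      - (x * - y)   ≈⟨ -‿cong (sym (-‿distribʳ-* _ _)) ⟩
      - - (x * y)   ≈⟨ -‿involutive _ ⟩
      x * y         ∎

  fromℤ-neg : ∀ i → fromℤ (ℤ.- i) ≈ - fromℤ i
  fromℤ-neg (+ zero)  = sym -0#≈0#
  fromℤ-neg (+ suc n) = refl
  fromℤ-neg -[1+ n ]  = sym (-‿involutive _)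

  morphism : ℤ.+-*-rawRing -Raw-AlmostCommutative⟶ fromCommutativeRing R
  morphism = record
    { ⟦_⟧    = fromℤ
    ; +-homo = fromℤ-+
    ; *-homo = fromℤ-*
    ; -‿homo = fromℤ-neg
    ; 0-homo = refl
    ; 1-homo = refl
    }

  -- Equality is decided on the integers because that test computes; the decision procedure of an
  -- abstract carrier is opaque, and the solver could not cancel coefficients with it.
  _coeff≟_ : ∀ i j → Maybe (fromℤ i ≈ fromℤ j)
  i coeff≟ j = map (λ i≡j → reflexive (≡.cong fromℤ i≡j)) (dec⇒maybe (i ℤ.≟ j))

  open RingSolver ℤ.+-*-rawRing (fromCommutativeRing R) morphism _coeff≟_ public
    using (solve; _:=_; _:+_; _:*_; _:-_; :-_; con; Polynomial)

-- Arithmetic and limits in a complete ordered field.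

module OrderedField {c ℓ₁ ℓ₂} (ℝ : CompleteOrderedField c ℓ₁ ℓ₂) where
  open CompleteOrderedField ℝ public
  open CommutativeRing commutativeRing public
    using (refl; sym; trans; reflexive; +-cong; +-congˡ; +-congʳ; *-cong; *-congˡ; *-congʳ;
           -‿cong; +-comm; +-assoc; *-comm; *-assoc; +-identityˡ; +-identityʳ; *-identityˡ; *-identityʳ;
           zeroˡ; zeroʳ; distribˡ; distribʳ; -‿inverseʳ)
  open IntegerCoefficients commutativeRing public
  open IsDecTotalOrder isDecTotalOrder public
    using (antisym; _≟_; _≤?_)
    renaming (total to ≤-total; refl to ≤-refl; reflexive to ≤-reflexive; trans to ≤-trans)

  poset : Poset c ℓ₁ ℓ₂
  poset = record { isPartialOrder = IsDecTotalOrder.isPartialOrder isDecTotalOrder }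

  open import Relation.Binary.Reasoning.PartialOrder poset public

  :1 : ∀ {n} → Polynomial n
  :1 = con (+ 1)

  :0 : ∀ {n} → Polynomial n
  :0 = con (+ 0)

  -- Decidability of the order is what turns facts known up to double negation, such as those about
  -- limits, into actual inequalities.
  ≤-stable : ∀ {x y} → ¬ ¬ x ≤ y → x ≤ y
  ≤-stable {x} {y} = decidable-stable (x ≤? y)

  ≤-resp : ∀ {x x′ y y′} → x ≈ x′ → y ≈ y′ → x ≤ y → x′ ≤ y′
  ≤-resp p q x≤y = ≤-trans (≤-reflexive (sym p)) (≤-trans x≤y (≤-reflexive q))

  <⇒≤ : ∀ {x y} → x < y → x ≤ y
  <⇒≤ = proj₁

  <⇒≱ : ∀ {x y} → x < y → ¬ y ≤ x
  <⇒≱ (x≤y , x≉y) y≤x = x≉y (antisym x≤y y≤x)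

  ≰⇒> : ∀ {x y} → ¬ x ≤ y → y < x
  ≰⇒> {x} {y} x≰y with ≤-total x y
  ... | inj₁ x≤y = contradiction x≤y x≰y
  ... | inj₂ y≤x = y≤x , λ y≈x → x≰y (≤-reflexive (sym y≈x))

  ≮⇒≥ : ∀ {x y} → ¬ x < y → y ≤ x
  ≮⇒≥ x≮y = ≤-stable λ y≰x → x≮y (≰⇒> y≰x)

  <-≤-trans : ∀ {x y z} → x < y → y ≤ z → x < z
  <-≤-trans x<y y≤z = ≰⇒> λ z≤x → <⇒≱ x<y (≤-trans y≤z z≤x)

  <-resp : ∀ {x x′ y y′} → x ≈ x′ → y ≈ y′ → x < y → x′ < y′
  <-resp p q (x≤y , x≉y) = ≤-resp p q x≤y , λ x′≈y′ → x≉y (trans p (trans x′≈y′ (sym q)))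

  +-mono-≤ : ∀ {x y u v} → x ≤ y → u ≤ v → x + u ≤ y + v
  +-mono-≤ {x} {y} {u} {v} x≤y u≤v =
    ≤-trans (+-monoˡ-≤ u x≤y) (≤-resp (+-comm u y) (+-comm v y) (+-monoˡ-≤ y u≤v))

  +-nonNeg : ∀ {x y} → 0# ≤ x → 0# ≤ y → 0# ≤ x + y
  +-nonNeg p q = ≤-resp (+-identityˡ 0#) refl (+-mono-≤ p q)

  x≤y⇒0≤y-x : ∀ {x y} → x ≤ y → 0# ≤ y - x
  x≤y⇒0≤y-x {x} x≤y = ≤-resp (-‿inverseʳ x) refl (+-monoˡ-≤ (- x) x≤y)

  -- Nearly every inequality below is certified by exhibiting the difference
  -- of its sides as a combination of nonnegative products.
  ≤-by : ∀ {x y d} → 0# ≤ d → y - x ≈ d → x ≤ y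
  ≤-by {x} {y} {d} 0≤d e = ≤-resp (+-identityˡ x) d+x≈y (+-monoˡ-≤ x 0≤d)
    where
    d+x≈y : d + x ≈ y
    d+x≈y = trans (+-congʳ (sym e)) (solve 2 (λ x y → y :- x :+ x := y) refl x y)

  neg-mono-≤ : ∀ {x y} → x ≤ y → - y ≤ - x
  neg-mono-≤ {x} {y} x≤y = ≤-by (x≤y⇒0≤y-x x≤y) (solve 2 (λ x y → :- x :- :- y := y :- x) refl x y)

  *-monoˡ-≤ : ∀ {x y z} → 0# ≤ z → x ≤ y → z * x ≤ z * y
  *-monoˡ-≤ {x} {y} {z} 0≤z x≤y = ≤-by (*-nonNeg 0≤z (x≤y⇒0≤y-x x≤y))
    (solve 3 (λ x y z → z :* y :- z :* x := z :* (y :- x)) refl x y z)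

  *-monoʳ-≤ : ∀ {x y z} → 0# ≤ z → x ≤ y → x * z ≤ y * z
  *-monoʳ-≤ 0≤z x≤y = ≤-resp (*-comm _ _) (*-comm _ _) (*-monoˡ-≤ 0≤z x≤y)

  *-mono-≤ : ∀ {x y u v} → 0# ≤ u → 0# ≤ y → x ≤ y → u ≤ v → x * u ≤ y * v
  *-mono-≤ 0≤u 0≤y x≤y u≤v = ≤-trans (*-monoʳ-≤ 0≤u x≤y) (*-monoˡ-≤ 0≤y u≤v)

  square-nonNeg : ∀ x → 0# ≤ x * x
  square-nonNeg x with ≤-total 0# x
  ... | inj₁ 0≤x = *-nonNeg 0≤x 0≤x
  ... | inj₂ x≤0 = ≤-resp refl (solve 1 (λ x → (:0 :- x) :* (:0 :- x) := x :* x) refl x)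
                     (*-nonNeg (x≤y⇒0≤y-x x≤0) (x≤y⇒0≤y-x x≤0))

  0≤1 : 0# ≤ 1#
  0≤1 = ≤-resp refl (*-identityˡ 1#) (square-nonNeg 1#)

  0<1 : 0# < 1#
  0<1 = 0≤1 , λ 0≈1 → 1≉0 (sym 0≈1)

  -- The order axiom only yields a nonnegative product; strictness comes from multiplying a
  -- vanishing product by `x ⁻¹`.
  *-pos : ∀ {x y} → 0# < x → 0# < y → 0# < x * y
  *-pos {x} {y} (0≤x , 0≉x) (0≤y , 0≉y) = *-nonNeg 0≤x 0≤y , λ 0≈xy → 0≉y (begin-equality
    0#                ≈⟨ zeroˡ (x ⁻¹) ⟨
    0# * x ⁻¹         ≈⟨ *-congʳ 0≈xy ⟩
    x * y * x ⁻¹      ≈⟨ solve 3 (λ x y z → x :* y :* z := x :* z :* y) refl x y (x ⁻¹) ⟩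
    x * x ⁻¹ * y      ≈⟨ *-congʳ (⁻¹-inverse λ x≈0 → 0≉x (sym x≈0)) ⟩
    1# * y            ≈⟨ *-identityˡ y ⟩
    y                 ∎)

  +-pos-nonNeg : ∀ {x y} → 0# < x → 0# ≤ y → 0# < x + y
  +-pos-nonNeg {x} {y} 0<x 0≤y = <-≤-trans 0<x
    (≤-by 0≤y (solve 2 (λ x y → x :+ y :- x := y) refl x y))

  +-nonNeg-pos : ∀ {x y} → 0# ≤ x → 0# < y → 0# < x + y
  +-nonNeg-pos 0≤x 0<y = <-resp refl (+-comm _ _) (+-pos-nonNeg 0<y 0≤x)

  x<y⇒0<y-x : ∀ {x y} → x < y → 0# < y - x
  x<y⇒0<y-x {x} {y} x<y = ≰⇒> λ y-x≤0 → <⇒≱ x<y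
    (≤-by (x≤y⇒0≤y-x y-x≤0) (solve 2 (λ x y → x :- y := :0 :- (y :- x)) refl x y))

  0<y-x⇒x<y : ∀ {x y} → 0# < y - x → x < y
  0<y-x⇒x<y {x} {y} p = ≰⇒> λ y≤x → <⇒≱ p
    (≤-by (x≤y⇒0≤y-x y≤x) (solve 2 (λ x y → :0 :- (y :- x) := x :- y) refl x y))

  ≉0 : ∀ {x} → 0# < x → x ≉ 0#
  ≉0 (_ , 0≉x) x≈0 = 0≉x (sym x≈0)

  *-cancel-nonNeg : ∀ {p x} → 0# < p → 0# ≤ p * x → 0# ≤ x
  *-cancel-nonNeg {p} {x} 0<p 0≤px = ≤-stable λ 0≰x →
    <⇒≱ (*-pos 0<p (x<y⇒0<y-x (≰⇒> 0≰x)))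
        (≤-by 0≤px (solve 2 (λ p x → :0 :- p :* (:0 :- x) := p :* x) refl p x))

  *-cancel-pos : ∀ {p x} → 0# ≤ p → 0# < p * x → 0# < x
  *-cancel-pos {p} {x} 0≤p 0<px = ≰⇒> λ x≤0 →
    <⇒≱ 0<px (≤-by (*-nonNeg 0≤p (x≤y⇒0≤y-x x≤0)) (solve 2 (λ p x → :0 :- p :* x := p :* (:0 :- x)) refl p x))

  *-cancelˡ-≤ : ∀ {p x y} → 0# < p → p * x ≤ p * y → x ≤ y
  *-cancelˡ-≤ {p} {x} {y} 0<p h = ≤-by (*-cancel-nonNeg 0<p (≤-resp refl
    (solve 3 (λ p x y → p :* y :- p :* x := p :* (y :- x)) refl p x y) (x≤y⇒0≤y-x h))) refl

  x*x⁻¹≈1 : ∀ {x} → 0# < x → x * x ⁻¹ ≈ 1#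
  x*x⁻¹≈1 0<x = ⁻¹-inverse (≉0 0<x)

  ⁻¹-pos : ∀ {x} → 0# < x → 0# < x ⁻¹
  ⁻¹-pos {x} 0<x = *-cancel-pos (<⇒≤ 0<x) (<-resp refl (sym (x*x⁻¹≈1 0<x)) 0<1)

  /-pos : ∀ {x y} → 0# < x → 0# < y → 0# < x / y
  /-pos 0<x 0<y = *-pos 0<x (⁻¹-pos 0<y)

  y*[x/y]≈x : ∀ {x y} → 0# < y → y * (x / y) ≈ x
  y*[x/y]≈x {x} {y} 0<y = begin-equality
    y * (x * y ⁻¹)   ≈⟨ solve 3 (λ x y z → y :* (x :* z) := y :* z :* x) refl x y (y ⁻¹) ⟩
    y * y ⁻¹ * x     ≈⟨ *-congʳ (x*x⁻¹≈1 0<y) ⟩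
    1# * x           ≈⟨ *-identityˡ x ⟩
    x                ∎

  x/y≤z : ∀ {x y z} → 0# < y → x ≤ y * z → x / y ≤ z
  x/y≤z 0<y h = *-cancelˡ-≤ 0<y (≤-resp (sym (y*[x/y]≈x 0<y)) refl h)

  z≤x/y : ∀ {x y z} → 0# < y → y * z ≤ x → z ≤ x / y
  z≤x/y 0<y h = *-cancelˡ-≤ 0<y (≤-resp refl (sym (y*[x/y]≈x 0<y)) h)

  0<2 : 0# < 1# + 1#
  0<2 = +-pos-nonNeg 0<1 0≤1

  half : Carrier → Carrier
  half x = x / (1# + 1#)

  half-pos : ∀ {x} → 0# < x → 0# < half x
  half-pos 0<x = /-pos 0<x 0<2

  half+half : ∀ x → half x + half x ≈ x
  half+half x = trans (solve 1 (λ h → h :+ h := (:1 :+ :1) :* h) refl (half x)) (y*[x/y]≈x 0<2)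

  double-nonNeg : ∀ {x} → 0# ≤ x + x → 0# ≤ x
  double-nonNeg {x} p = *-cancel-nonNeg 0<2 (≤-resp refl (solve 1 (λ h → h :+ h := (:1 :+ :1) :* h) refl x) p)

  fromℕ-nonNeg : ∀ n → 0# ≤ fromℕ n
  fromℕ-nonNeg zero    = ≤-refl
  fromℕ-nonNeg (suc n) = +-nonNeg 0≤1 (fromℕ-nonNeg n)

  fromℕ-pos : ∀ {n} → 0 ℕ.< n → 0# < fromℕ n
  fromℕ-pos {suc n} _ = +-pos-nonNeg 0<1 (fromℕ-nonNeg n)

  fromℕ-mono : ∀ {m n} → m ℕ.≤ n → fromℕ m ≤ fromℕ n
  fromℕ-mono {n = n} z≤n = fromℕ-nonNeg n
  fromℕ-mono (s≤s m≤n)   = +-mono-≤ ≤-refl (fromℕ-mono m≤n)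

  -- Otherwise the naturals would have a supremum `s`. They are closed under adding `1#`, so
  -- `s - 1#` would bound them as well. The contradiction exhibits no index, hence the double
  -- negation.
  archimedean : ∀ x → ¬ ¬ (∃[ n ] x ≤ fromℕ n)
  archimedean x none = <⇒≱ s-1<s (least (s - 1#) pred-bounds)
    where
    fromℕ≤x : ∀ n → fromℕ n ≤ x
    fromℕ≤x n = <⇒≤ (≰⇒> λ x≤n → none (n , x≤n))

    -- `Lift` raises the predicate to the universe level that `supremum` expects.
    sup = supremum (λ y → Lift (c ⊔ ℓ₂) (∃[ n ] y ≈ fromℕ n)) (0# , lift (0 , refl))
            (x , λ { y (lift (n , y≈n)) → ≤-trans (≤-reflexive y≈n) (fromℕ≤x n) })
    s     = proj₁ sup
    least = proj₂ (proj₂ sup)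

    s-1<s : s - 1# < s
    s-1<s = 0<y-x⇒x<y (<-resp refl (solve 2 (λ s o → o := s :- (s :- o)) refl s 1#) 0<1)

    pred-bounds : ∀ y → Lift (c ⊔ ℓ₂) (∃[ n ] y ≈ fromℕ n) → y ≤ s - 1#
    pred-bounds y (lift (n , y≈n)) = ≤-by
      (x≤y⇒0≤y-x (proj₁ (proj₂ sup) (1# + y) (lift (suc n , +-congˡ y≈n))))
      (solve 3 (λ s y o → s :- o :- y := s :- (o :+ y)) refl s y 1#)

  infix 4 _⊴_

  -- The bound |x| ≤ a as two inequalities, so that adding and multiplying bounds needs no case
  -- distinction on signs.
  _⊴_ : Carrier → Carrier → Set ℓ₂
  x ⊴ a = (- a ≤ x) × (x ≤ a)

  ⊴-resp : ∀ {x x′ a a′} → x ≈ x′ → a ≈ a′ → x ⊴ a → x′ ⊴ a′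
  ⊴-resp p q (l , u) = ≤-resp (-‿cong q) p l , ≤-resp p q u

  ⊴-bound : ∀ {x a} → x ⊴ a → 0# ≤ a
  ⊴-bound {x} {a} (l , u) = double-nonNeg (≤-by
    (+-nonNeg (x≤y⇒0≤y-x l) (x≤y⇒0≤y-x u))
    (solve 2 (λ x a → a :+ a :- :0 := x :- :- a :+ (a :- x)) refl x a))

  nonNeg-⊴ : ∀ {x a} → 0# ≤ x → x ≤ a → x ⊴ a
  nonNeg-⊴ {x} {a} 0≤x x≤a = ≤-by (+-nonNeg 0≤x (≤-trans 0≤x x≤a)) (solve 2 (λ x a → x :- :- a := x :+ a) refl x a) , x≤a

  ⊴-trans : ∀ {x a b} → x ⊴ a → a ≤ b → x ⊴ b
  ⊴-trans (l , u) a≤b = ≤-trans (neg-mono-≤ a≤b) l , ≤-trans u a≤b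

  ⊴-+ : ∀ {x y a b} → x ⊴ a → y ⊴ b → x + y ⊴ a + b
  ⊴-+ {a = a} {b} (l , u) (l′ , u′) =
    ≤-resp (solve 2 (λ a b → :- a :+ :- b := :- (a :+ b)) refl a b) refl (+-mono-≤ l l′) , +-mono-≤ u u′

  -- Both 2(ab + xy) = (a + x)(b + y) + (a - x)(b - y) and 2(ab - xy) = (a + x)(b - y) + (a - x)(b +
  -- y) are sums of nonnegative products.
  ⊴-* : ∀ {x y a b} → x ⊴ a → y ⊴ b → x * y ⊴ a * b
  ⊴-* {x} {y} {a} {b} (l , u) (l′ , u′) =
    ≤-by (double-nonNeg (≤-resp refl
      (solve 4 (λ x y a b → (x :- :- a) :* (y :- :- b) :+ (a :- x) :* (b :- y)
                 := (x :* y :- :- (a :* b)) :+ (x :* y :- :- (a :* b))) refl x y a b)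
      (+-nonNeg (*-nonNeg (x≤y⇒0≤y-x l) (x≤y⇒0≤y-x l′)) (*-nonNeg (x≤y⇒0≤y-x u) (x≤y⇒0≤y-x u′))))) refl ,
    ≤-by (double-nonNeg (≤-resp refl
      (solve 4 (λ x y a b → (x :- :- a) :* (b :- y) :+ (a :- x) :* (y :- :- b)
                 := (a :* b :- x :* y) :+ (a :* b :- x :* y)) refl x y a b)
      (+-nonNeg (*-nonNeg (x≤y⇒0≤y-x l) (x≤y⇒0≤y-x u′)) (*-nonNeg (x≤y⇒0≤y-x u) (x≤y⇒0≤y-x l′))))) refl

  ∣_∣ : Carrier → Carrier
  ∣ x ∣ with ≤-total 0# x
  ... | inj₁ _ = x
  ... | inj₂ _ = - x

  ⊴-∣∣ : ∀ x → x ⊴ ∣ x ∣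
  ⊴-∣∣ x with ≤-total 0# x
  ... | inj₁ 0≤x = nonNeg-⊴ 0≤x ≤-refl
  ... | inj₂ x≤0 = ≤-reflexive (solve 1 (λ x → :- :- x := x) refl x) ,
    ≤-by (+-nonNeg (x≤y⇒0≤y-x x≤0) (x≤y⇒0≤y-x x≤0)) (solve 1 (λ x → :- x :- x := :0 :- x :+ (:0 :- x)) refl x)

  -- Limits up to double negation: the Archimedean property provides no
  -- explicit index, while every conclusion drawn from a limit is stable.
  Eventually : ∀ {p} → (ℕ → Set p) → Set p
  Eventually P = ¬ ¬ (∃[ N ] ∀ n → N ℕ.≤ n → P n)

  eventually₂ : ∀ {p q r} {P : ℕ → Set p} {Q : ℕ → Set q} {S : ℕ → Set r} →
                (∀ n → P n → Q n → S n) → Eventually P → Eventually Q → Eventually S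
  eventually₂ f p q k = p λ (N , hN) → q λ (M , hM) →
    k (N ℕ.⊔ M , λ n n≥ → f n (hN n (ℕ.≤-trans (ℕ.m≤m⊔n N M) n≥)) (hM n (ℕ.≤-trans (ℕ.m≤n⊔m N M) n≥)))

  eventually : ∀ {p q} {P : ℕ → Set p} {Q : ℕ → Set q} →
               (∀ n → P n → Q n) → Eventually P → Eventually Q
  eventually f p k = p λ (N , hN) → k (N , λ n n≥ → f n (hN n n≥))

  always : ∀ {p} {P : ℕ → Set p} → (∀ n → P n) → Eventually P
  always h k = k (0 , λ n _ → h n)

  Null : (ℕ → Carrier) → Set (c ⊔ ℓ₁ ⊔ ℓ₂)
  Null u = ∀ ε → 0# < ε → Eventually (λ n → u n ⊴ ε)

  null-dominated : ∀ {u v} → Eventually (λ n → u n ⊴ v n) → Null v → Null u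
  null-dominated h hv ε 0<ε = eventually₂ (λ n p q → ⊴-trans p (proj₂ q)) h (hv ε 0<ε)

  null-+ : ∀ {u v} → Null u → Null v → Null (λ n → u n + v n)
  null-+ hu hv ε 0<ε = eventually₂ (λ n p q → ⊴-resp refl (half+half ε) (⊴-+ p q))
    (hu (half ε) (half-pos 0<ε)) (hv (half ε) (half-pos 0<ε))

  null-scale : ∀ {u} x → Null u → Null (λ n → x * u n)
  null-scale {u} x hu ε 0<ε = eventually (λ n p → ⊴-resp refl (y*[x/y]≈x 0<a) (⊴-* x⊴a p))
    (hu (ε / a) (/-pos 0<ε 0<a))
    where
    -- The summand `1#` keeps the divisor positive when `x` is 0.
    a = 1# + ∣ x ∣
    0<a : 0# < a
    0<a = +-pos-nonNeg 0<1 (⊴-bound (⊴-∣∣ x))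
    x⊴a : x ⊴ a
    x⊴a = ⊴-trans (⊴-∣∣ x) (≤-by 0≤1 (solve 2 (λ o y → o :+ y :- y := o) refl 1# ∣ x ∣))

  null-* : ∀ {u v} → Null u → Null v → Null (λ n → u n * v n)
  null-* hu hv ε 0<ε = eventually₂ (λ n p q → ⊴-resp refl (*-identityˡ ε) (⊴-* p q))
    (hu 1# 0<1) (hv ε 0<ε)

  null-resp : ∀ {u v} → (∀ n → u n ≈ v n) → Null u → Null v
  null-resp h hu ε 0<ε = eventually (λ n → ⊴-resp (h n) refl) (hu ε 0<ε)

  Lim : (ℕ → Carrier) → Carrier → Set (c ⊔ ℓ₁ ⊔ ℓ₂)
  Lim a l = Null (λ n → a n - l)

  lim-const : ∀ x → Lim (λ _ → x) x
  lim-const x ε 0<ε = always λ _ → nonNeg-⊴ (≤-reflexive (sym (-‿inverseʳ x)))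
    (≤-trans (≤-reflexive (-‿inverseʳ x)) (<⇒≤ 0<ε))

  lim-+ : ∀ {a b l m} → Lim a l → Lim b m → Lim (λ n → a n + b n) (l + m)
  lim-+ {a} {b} {l} {m} ha hb = null-resp
    (λ n → solve 4 (λ a b l m → a :- l :+ (b :- m) := a :+ b :- (l :+ m)) refl (a n) (b n) l m)
    (null-+ ha hb)

  lim-* : ∀ {a b l m} → Lim a l → Lim b m → Lim (λ n → a n * b n) (l * m)
  lim-* {a} {b} {l} {m} ha hb = null-resp
    (λ n → solve 4 (λ a b l m → (a :- l) :* (b :- m) :+ (l :* (b :- m) :+ m :* (a :- l))
                     := a :* b :- l :* m) refl (a n) (b n) l m)
    (null-+ (null-* ha hb) (null-+ (null-scale l hb) (null-scale m ha)))

  -- If l < 0, take ε = - l / 2. A late term satisfies 0 ≤ a n ≤ l + ε = - ε, and the resulting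
  -- `ε ≤ 0#` no longer mentions `n`.
  lim-nonNeg : ∀ {a l} → Eventually (λ n → 0# ≤ a n) → Lim a l → 0# ≤ l
  lim-nonNeg {a} {l} h ha = ≤-stable λ 0≰l → let 0<ε = half-pos (x<y⇒0<y-x (≰⇒> 0≰l)) in
    eventually₂ {S = λ _ → ε ≤ 0#}
      (λ n p q → ≤-by (+-nonNeg p (x≤y⇒0≤y-x (proj₂ q))) (trans
        (+-congʳ (trans (solve 1 (λ l → :0 := l :+ (:0 :- l)) refl l) (+-congˡ (sym (half+half (0# - l))))))
        (solve 3 (λ e l a → l :+ (e :+ e) :- e := a :+ (e :- (a :- l))) refl ε l (a n))))
      h (ha ε 0<ε) λ (N , hN) → <⇒≱ 0<ε (hN N ℕ.≤-refl)
    where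
    ε = half (0# - l)

  lim-≤ : ∀ {a b l m} → Eventually (λ n → a n ≤ b n) → Lim a l → Lim b m → l ≤ m
  lim-≤ {a} {b} {l} {m} h ha hb = ≤-by (lim-nonNeg (eventually (λ _ → x≤y⇒0≤y-x) h)
    (null-resp (λ n → solve 4 (λ a b l m → (b :- m) :+ :- :1 :* (a :- l) := b :- a :- (m :- l)) refl (a n) (b n) l m)
      (null-+ hb (null-scale (- 1#) ha)))) refl

-- The exponential series: addition formula and tangent inequality.

module Exponential {c ℓ₁ ℓ₂} (ℝ : CompleteOrderedField c ℓ₁ ℓ₂) where
  open OrderedField ℝ
  open SemiringMultiplication semiring using (×1-homo-*)

  *-cancelˡ-≈ : ∀ {p x y} → 0# < p → p * x ≈ p * y → x ≈ y
  *-cancelˡ-≈ 0<p e = antisym (*-cancelˡ-≤ 0<p (≤-reflexive e)) (*-cancelˡ-≤ 0<p (≤-reflexive (sym e)))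

  Seq : Set c
  Seq = ℕ → Carrier

  partialSum : Seq → Seq
  partialSum f n = sum {n} (λ k → f (toℕ k))

  partialSum-suc : ∀ f n → partialSum f (suc n) ≈ partialSum f n + f n
  partialSum-suc f zero    = +-comm _ _
  partialSum-suc f (suc n) = trans (+-congˡ (partialSum-suc (f ∘ suc) n)) (sym (+-assoc _ _ _))

  partialSum-cong : ∀ {f g} → (∀ k → f k ≈ g k) → ∀ n → partialSum f n ≈ partialSum g n
  partialSum-cong h zero    = refl
  partialSum-cong h (suc n) = +-cong (h 0) (partialSum-cong (h ∘ suc) n)

  partialSum-nonNeg : ∀ {f} → (∀ k → 0# ≤ f k) → ∀ n → 0# ≤ partialSum f n
  partialSum-nonNeg h zero    = ≤-refl
  partialSum-nonNeg h (suc n) = +-nonNeg (h 0) (partialSum-nonNeg (h ∘ suc) n)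

  partialSum-difference-⊴ : ∀ {f g} → (∀ k → f k ⊴ g k) → ∀ {k n} → k ℕ.≤ n →
    partialSum f n - partialSum f k ⊴ partialSum g n - partialSum g k
  partialSum-difference-⊴ {f} {g} h = go ∘ ℕ.≤⇒≤′
    where
    go : ∀ {k n} → k ℕ.≤′ n → partialSum f n - partialSum f k ⊴ partialSum g n - partialSum g k
    go (ℕ.≤′-reflexive ≡.refl) = ⊴-resp (sym (-‿inverseʳ _)) (sym (-‿inverseʳ _)) (nonNeg-⊴ ≤-refl ≤-refl)
    go {k} {suc n} (ℕ.≤′-step k≤n) = ⊴-resp (step f) (step g) (⊴-+ (go k≤n) (h n))
      where
      step : ∀ f → partialSum f n - partialSum f k + f n ≈ partialSum f (suc n) - partialSum f k
      step f = trans (solve 3 (λ a b d → a :- b :+ d := a :+ d :- b) refl (partialSum f n) (partialSum f k) (f n))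
                     (+-congʳ (sym (partialSum-suc f n)))

  -- The Cauchy product, the sum of f k · g (n - k) over k ≤ n. Shifting `f` in the recursion avoids
  -- subtracting indices.
  conv : Seq → Seq → Seq
  conv f g zero    = f 0 * g 0
  conv f g (suc n) = f 0 * g (suc n) + conv (f ∘ suc) g n

  conv-cong : ∀ {f f′ g g′} → (∀ k → f k ≈ f′ k) → (∀ k → g k ≈ g′ k) → ∀ n → conv f g n ≈ conv f′ g′ n
  conv-cong p q zero    = *-cong (p 0) (q 0)
  conv-cong p q (suc n) = +-cong (*-cong (p 0) (q (suc n))) (conv-cong (p ∘ suc) q n)

  -- The definition splits off index 0 of `f`; splitting off index 0 of `g` instead is what lets a
  -- shift act on `g`.
  conv-suc : ∀ f g n → conv f g (suc n) ≈ conv f (g ∘ suc) n + f (suc n) * g 0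
  conv-suc f g zero    = refl
  conv-suc f g (suc n) = trans (+-congˡ (conv-suc (f ∘ suc) g n)) (sym (+-assoc _ _ _))

  conv-+ˡ : ∀ f f′ g n → conv (λ k → f k + f′ k) g n ≈ conv f g n + conv f′ g n
  conv-+ˡ f f′ g zero    = distribʳ _ _ _
  conv-+ˡ f f′ g (suc n) = trans (+-congˡ (conv-+ˡ (f ∘ suc) (f′ ∘ suc) g n))
    (solve 5 (λ a b x u v → (a :+ b) :* x :+ (u :+ v) := a :* x :+ u :+ (b :* x :+ v)) refl
      (f 0) (f′ 0) (g (suc n)) (conv (f ∘ suc) g n) (conv (f′ ∘ suc) g n))

  conv-+ʳ : ∀ f g g′ n → conv f (λ k → g k + g′ k) n ≈ conv f g n + conv f g′ n
  conv-+ʳ f g g′ zero    = distribˡ _ _ _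
  conv-+ʳ f g g′ (suc n) = trans (+-congˡ (conv-+ʳ (f ∘ suc) g g′ n))
    (solve 5 (λ x a b u v → x :* (a :+ b) :+ (u :+ v) := x :* a :+ u :+ (x :* b :+ v)) refl
      (f 0) (g (suc n)) (g′ (suc n)) (conv (f ∘ suc) g n) (conv (f ∘ suc) g′ n))

  conv-scaleˡ : ∀ x f g n → conv (λ k → x * f k) g n ≈ x * conv f g n
  conv-scaleˡ x f g zero    = *-assoc _ _ _
  conv-scaleˡ x f g (suc n) = trans (+-congˡ (conv-scaleˡ x (f ∘ suc) g n))
    (solve 4 (λ x a b u → x :* a :* b :+ x :* u := x :* (a :* b :+ u)) refl x (f 0) (g (suc n)) (conv (f ∘ suc) g n))

  conv-scaleʳ : ∀ x f g n → conv f (λ k → x * g k) n ≈ x * conv f g n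
  conv-scaleʳ x f g zero    = solve 3 (λ x a b → a :* (x :* b) := x :* (a :* b)) refl x (f 0) (g 0)
  conv-scaleʳ x f g (suc n) = trans (+-congˡ (conv-scaleʳ x (f ∘ suc) g n))
    (solve 4 (λ x a b u → a :* (x :* b) :+ x :* u := x :* (a :* b :+ u)) refl x (f 0) (g (suc n)) (conv (f ∘ suc) g n))

  conv-constʳ : ∀ f x n → conv f (λ _ → x) n ≈ partialSum f (suc n) * x
  conv-constʳ f x zero    = *-congʳ (sym (+-identityʳ _))
  conv-constʳ f x (suc n) = trans (+-congˡ (conv-constʳ (f ∘ suc) x n)) (sym (distribʳ _ _ _))

  conv-⊴ : ∀ {f f′ g g′} n → (∀ k → f k ⊴ f′ k) → (∀ k → k ℕ.≤ n → g k ⊴ g′ k) → conv f g n ⊴ conv f′ g′ n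
  conv-⊴ zero    p q = ⊴-* (p 0) (q 0 ℕ.≤-refl)
  conv-⊴ (suc n) p q = ⊴-+ (⊴-* (p 0) (q (suc n) ℕ.≤-refl))
    (conv-⊴ n (p ∘ suc) (λ k k≤n → q k (ℕ.m≤n⇒m≤1+n k≤n)))

  conv-nonNeg : ∀ {f g} → (∀ k → 0# ≤ f k) → (∀ k → 0# ≤ g k) → ∀ n → 0# ≤ conv f g n
  conv-nonNeg p q zero    = *-nonNeg (p 0) (q 0)
  conv-nonNeg p q (suc n) = +-nonNeg (*-nonNeg (p 0) (q (suc n))) (conv-nonNeg (p ∘ suc) q n)

  -- In the summands with k ≤ p the index of `g` is p + n - k ≥ n, so monotonicity bounds the factor
  -- below by `g n`; the remaining summands are nonnegative.
  conv-lowerBound : ∀ {f g} → (∀ k → 0# ≤ f k) → (∀ k → 0# ≤ g k) → (∀ k → g k ≤ g (suc k)) →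
                    ∀ p n → partialSum f (suc p) * g n ≤ conv f g (p ℕ.+ n)
  conv-lowerBound {f} {g} 0≤f 0≤g mono zero    n = ≤-trans (≤-reflexive (*-congʳ (+-identityʳ _))) (head≤ n)
    where
    head≤ : ∀ n → f 0 * g n ≤ conv f g n
    head≤ zero    = ≤-refl
    head≤ (suc n) = ≤-trans (≤-reflexive (sym (+-identityʳ _)))
                      (+-mono-≤ ≤-refl (conv-nonNeg (0≤f ∘ suc) 0≤g n))
  conv-lowerBound {f} {g} 0≤f 0≤g mono (suc p) n = ≤-trans (≤-reflexive (distribʳ _ _ _))
    (+-mono-≤ (*-monoˡ-≤ (0≤f 0) (mono+ (suc p))) (conv-lowerBound (0≤f ∘ suc) 0≤g mono p n))
    where
    mono+ : ∀ p → g n ≤ g (p ℕ.+ n)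
    mono+ zero    = ≤-refl
    mono+ (suc p) = ≤-trans (mono+ p) (mono _)

  -- Both sides add up f k · g l over k + l < n; the summand k = n on the right carries an empty
  -- partial sum.
  partialSum-conv : ∀ f g n → partialSum (conv f g) n ≈ conv f (partialSum g) n
  partialSum-conv f g zero    = sym (zeroʳ _)
  partialSum-conv f g (suc n) = begin-equality
    partialSum (conv f g) (suc n)                              ≈⟨ partialSum-suc (conv f g) n ⟩
    partialSum (conv f g) n + conv f g n                       ≈⟨ +-congʳ (partialSum-conv f g n) ⟩
    conv f (partialSum g) n + conv f g n                       ≈⟨ conv-+ʳ f (partialSum g) g n ⟨
    conv f (λ k → partialSum g k + g k) n                      ≈⟨ conv-cong (λ _ → refl) (λ k → partialSum-suc g k) n ⟨
    conv f (partialSum g ∘ suc) n                              ≈⟨ +-identityʳ _ ⟨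
    conv f (partialSum g ∘ suc) n + 0#                         ≈⟨ +-congˡ (zeroʳ _) ⟨
    conv f (partialSum g ∘ suc) n + f (suc n) * 0#             ≈⟨ conv-suc f (partialSum g) n ⟨
    conv f (partialSum g) (suc n)                              ∎

  -- The operator z d/dz on coefficient sequences of power series.
  weighted : Seq → Seq
  weighted f k = fromℕ k * f k

  -- The Leibniz rule: in each summand of the Cauchy product n splits as k + (n - k).
  conv-leibniz : ∀ f g n → fromℕ n * conv f g n ≈ conv (weighted f) g n + conv f (weighted g) n
  conv-leibniz f g zero    = solve 2 (λ a b → :0 :* (a :* b) := :0 :* a :* b :+ a :* (:0 :* b)) refl (f 0) (g 0)
  conv-leibniz f g (suc n) = begin-equality
    (1# + fromℕ n) * (f 0 * g (suc n) + conv f⁺ g n)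
      ≈⟨ solve 4 (λ N a b u → (:1 :+ N) :* (a :* b :+ u) := :0 :* a :* b :+ u :+ (a :* ((:1 :+ N) :* b)) :+ N :* u) refl
           (fromℕ n) (f 0) (g (suc n)) (conv f⁺ g n) ⟩
    0# * f 0 * g (suc n) + conv f⁺ g n + f 0 * weighted g (suc n) + fromℕ n * conv f⁺ g n
      ≈⟨ +-congˡ (conv-leibniz f⁺ g n) ⟩
    0# * f 0 * g (suc n) + conv f⁺ g n + f 0 * weighted g (suc n) + (conv (weighted f⁺) g n + conv f⁺ (weighted g) n)
      ≈⟨ solve 5 (λ a b d e h → a :+ b :+ d :+ (e :+ h) := a :+ (b :+ e) :+ (d :+ h)) refl
           (0# * f 0 * g (suc n)) (conv f⁺ g n) (f 0 * weighted g (suc n)) (conv (weighted f⁺) g n) (conv f⁺ (weighted g) n) ⟩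
    0# * f 0 * g (suc n) + (conv f⁺ g n + conv (weighted f⁺) g n) + (f 0 * weighted g (suc n) + conv f⁺ (weighted g) n)
      ≈⟨ +-congʳ (+-congˡ (conv-+ˡ f⁺ (weighted f⁺) g n)) ⟨
    0# * f 0 * g (suc n) + conv (λ k → f⁺ k + weighted f⁺ k) g n + (f 0 * weighted g (suc n) + conv f⁺ (weighted g) n)
      ≈⟨ +-congʳ (+-congˡ (conv-cong (λ k → solve 2 (λ N a → (:1 :+ N) :* a := a :+ N :* a) refl (fromℕ k) (f⁺ k)) (λ _ → refl) n)) ⟨
    0# * f 0 * g (suc n) + conv (weighted f ∘ suc) g n + (f 0 * weighted g (suc n) + conv f⁺ (weighted g) n)
      ∎
    where f⁺ = f ∘ suc

  term : Carrier → Seq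
  term y k = y ^ k / fromℕ (k !)

  private
    0<k! : ∀ k → 0# < fromℕ (k !)
    0<k! k = fromℕ-pos (ℕ.1≤n! k)

  term-zero : ∀ y → term y 0 ≈ 1#
  term-zero y = trans (*-congʳ (sym (+-identityʳ 1#))) (x*x⁻¹≈1 (0<k! 0))

  term-suc : ∀ y k → fromℕ (suc k) * term y (suc k) ≈ y * term y k
  term-suc y k = *-cancelˡ-≈ (0<k! k) (begin-equality
    fromℕ (k !) * (fromℕ (suc k) * term y (suc k))
      ≈⟨ solve 3 (λ a b d → a :* (b :* d) := b :* a :* d) refl (fromℕ (k !)) (fromℕ (suc k)) (term y (suc k)) ⟩
    fromℕ (suc k) * fromℕ (k !) * term y (suc k)
      ≈⟨ *-congʳ (×1-homo-* (suc k) (k !)) ⟨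
    fromℕ (suc k !) * term y (suc k)
      ≈⟨ y*[x/y]≈x (0<k! (suc k)) ⟩
    y * y ^ k
      ≈⟨ *-congˡ (y*[x/y]≈x (0<k! k)) ⟨
    y * (fromℕ (k !) * term y k)
      ≈⟨ solve 3 (λ a b d → a :* (b :* d) := b :* (a :* d)) refl y (fromℕ (k !)) (term y k) ⟩
    fromℕ (k !) * (y * term y k) ∎)

  term-cong : ∀ {x y} → x ≈ y → ∀ k → term x k ≈ term y k
  term-cong {x} {y} x≈y k = *-congʳ (pow k)
    where
    pow : ∀ k → x ^ k ≈ y ^ k
    pow zero    = refl
    pow (suc k) = *-cong x≈y (pow k)

  term-⊴ : ∀ {x a} → x ⊴ a → ∀ k → term x k ⊴ term a k
  term-⊴ {x} {a} x⊴a k = ⊴-* (pow k) (nonNeg-⊴ (<⇒≤ (⁻¹-pos (0<k! k))) ≤-refl)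
    where
    pow : ∀ k → x ^ k ⊴ a ^ k
    pow zero    = nonNeg-⊴ 0≤1 ≤-refl
    pow (suc k) = ⊴-* x⊴a (pow k)

  term-nonNeg : ∀ {x} → 0# ≤ x → ∀ k → 0# ≤ term x k
  term-nonNeg 0≤x k = ⊴-bound (term-⊴ (nonNeg-⊴ 0≤x ≤-refl) k)

  -- The binomial theorem without binomial coefficients: by `term-suc` and the Leibniz rule, both
  -- sides satisfy (n + 1) u (n + 1) = (x + y) u n with the same initial value.
  term-+ : ∀ x y n → term (x + y) n ≈ conv (term x) (term y) n
  term-+ x y zero    = trans (term-zero (x + y)) (trans (sym (*-identityˡ 1#)) (sym (*-cong (term-zero x) (term-zero y))))
  term-+ x y (suc n) = *-cancelˡ-≈ (fromℕ-pos {suc n} ℕ.z<s) (begin-equality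
    fromℕ (suc n) * term (x + y) (suc n)
      ≈⟨ term-suc (x + y) n ⟩
    (x + y) * term (x + y) n
      ≈⟨ *-congˡ (term-+ x y n) ⟩
    (x + y) * convₙ
      -- The inserted zero products are the index-0 summands of the weighted sequences; they
      -- complete the scaled convolutions of order `n` to convolutions of order `suc n`.
      ≈⟨ solve 5 (λ x y u a b → (x :+ y) :* u := :0 :* a :+ x :* u :+ (y :* u :+ b :* :0)) refl x y convₙ (term x 0 * term y (suc n)) (term x (suc n)) ⟩
    0# * (term x 0 * term y (suc n)) + x * convₙ + (y * convₙ + term x (suc n) * 0#)
      ≈⟨ +-cong (+-cong (sym (*-assoc _ _ _)) (sym (conv-scaleˡ x (term x) (term y) n)))
                (+-cong (sym (conv-scaleʳ y (term x) (term y) n)) (*-congˡ (sym (zeroˡ (term y 0))))) ⟩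
    0# * term x 0 * term y (suc n) + conv (λ k → x * term x k) (term y) n
      + (conv (term x) (λ k → y * term y k) n + term x (suc n) * (0# * term y 0))
      ≈⟨ +-cong (+-congˡ (conv-cong (λ k → sym (term-suc x k)) (λ _ → refl) n))
                (+-congʳ (conv-cong (λ _ → refl) (λ k → sym (term-suc y k)) n)) ⟩
    conv (weighted (term x)) (term y) (suc n)
      + (conv (term x) (weighted (term y) ∘ suc) n + term x (suc n) * weighted (term y) 0)
      ≈⟨ +-congˡ (conv-suc (term x) (weighted (term y)) n) ⟨
    conv (weighted (term x)) (term y) (suc n) + conv (term x) (weighted (term y)) (suc n)
      ≈⟨ conv-leibniz (term x) (term y) (suc n) ⟨
    fromℕ (suc n) * conv (term x) (term y) (suc n) ∎)
    where convₙ = conv (term x) (term y) n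

  -- Unfolds to `expPartialSum`, so `IsExp` hypotheses apply without conversion. The argument `n`
  -- counts terms: the indices are k < n.
  exp : Carrier → Seq
  exp y = partialSum (term y)

  exp-+ : ∀ x y n → exp (x + y) n ≈ conv (term x) (exp y) n
  exp-+ x y n = trans (partialSum-cong (term-+ x y) n) (partialSum-conv (term x) (term y) n)

  -- The first factor gets one extra term so that it covers exactly the indices k ≤ n of a
  -- convolution of order `n`; this makes the defect a single convolution.
  defect : Carrier → Carrier → Seq
  defect x y n = exp x (suc n) * exp y n - exp (x + y) n

  defect-conv : ∀ x y n → defect x y n ≈ conv (term x) (λ k → exp y n - exp y k) n
  defect-conv x y n = begin-equality
    exp x (suc n) * exp y n - exp (x + y) n
      ≈⟨ +-cong (sym (conv-constʳ (term x) (exp y n) n)) (-‿cong (exp-+ x y n)) ⟩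
    conv (term x) (λ _ → exp y n) n - conv (term x) (exp y) n
      ≈⟨ solve 2 (λ a b → a :- b := a :+ :- :1 :* b) refl (conv (term x) (λ _ → exp y n) n) (conv (term x) (exp y) n) ⟩
    conv (term x) (λ _ → exp y n) n + - 1# * conv (term x) (exp y) n
      ≈⟨ +-congˡ (conv-scaleʳ (- 1#) (term x) (exp y) n) ⟨
    conv (term x) (λ _ → exp y n) n + conv (term x) (λ k → - 1# * exp y k) n
      ≈⟨ conv-+ʳ (term x) (λ _ → exp y n) (λ k → - 1# * exp y k) n ⟨
    conv (term x) (λ k → exp y n + - 1# * exp y k) n
      ≈⟨ conv-cong (λ _ → refl) (λ k → solve 2 (λ a b → a :+ :- :1 :* b := a :- b) refl (exp y n) (exp y k)) n ⟩
    conv (term x) (λ k → exp y n - exp y k) n ∎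

  defect-⊴ : ∀ {x y a b} → x ⊴ a → y ⊴ b → ∀ n → defect x y n ⊴ defect a b n
  defect-⊴ x⊴a y⊴b n = ⊴-resp (sym (defect-conv _ _ n)) (sym (defect-conv _ _ n))
    (conv-⊴ n (term-⊴ x⊴a) (λ k k≤n → partialSum-difference-⊴ (term-⊴ y⊴b) k≤n))

  -- Products of a term of index at most n and a term of index below n have total degree below 2n,
  -- so all of them occur in `exp (a + b) (n ℕ.+ n)`.
  defect≤tail : ∀ {a b} → 0# ≤ a → 0# ≤ b → ∀ n → defect a b n ≤ exp (a + b) (n ℕ.+ n) - exp (a + b) n
  defect≤tail {a} {b} 0≤a 0≤b n = +-monoˡ-≤ _ (≤-trans
    (conv-lowerBound (term-nonNeg 0≤a) (partialSum-nonNeg (term-nonNeg 0≤b)) mono n n)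
    (≤-reflexive (sym (exp-+ a b (n ℕ.+ n)))))
    where
    mono : ∀ k → exp b k ≤ exp b (suc k)
    mono k = ≤-by (term-nonNeg 0≤b k) (trans (+-congʳ (partialSum-suc (term b) k))
      (solve 2 (λ u v → u :+ v :- u := v) refl (exp b k) (term b k)))

  -- From index `K` on the ratio s / (n + 1) of consecutive terms is at most 1/2, so the tail
  -- compares with a geometric series.
  module Tail {s} (0≤s : 0# ≤ s) {K} (2s≤K : s + s ≤ fromℕ K) where
    0≤term : ∀ n → 0# ≤ term s n
    0≤term = term-nonNeg 0≤s

    term-halves : ∀ {n} → K ℕ.≤ n → term s (suc n) + term s (suc n) ≤ term s n
    term-halves {n} K≤n = *-cancelˡ-≤ (fromℕ-pos {suc n} ℕ.z<s) (begin
      fromℕ (suc n) * (term s (suc n) + term s (suc n))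
        ≈⟨ distribˡ _ _ _ ⟩
      fromℕ (suc n) * term s (suc n) + fromℕ (suc n) * term s (suc n)
        ≈⟨ +-cong (term-suc s n) (term-suc s n) ⟩
      s * term s n + s * term s n
        ≈⟨ distribʳ _ _ _ ⟨
      (s + s) * term s n
        ≤⟨ *-monoʳ-≤ (0≤term n) (≤-trans 2s≤K (fromℕ-mono (ℕ.m≤n⇒m≤1+n K≤n))) ⟩
      fromℕ (suc n) * term s n ∎)

    -- A geometric series in telescoped form: passing from k to k + 1 adds t_k to the sum and
    -- replaces 2 t_k by 2 t_(k+1) ≤ t_k, so the total does not increase.
    exp-growth : ∀ {n} → K ℕ.≤ n → ∀ m →
      exp s (m ℕ.+ n) + (term s (m ℕ.+ n) + term s (m ℕ.+ n)) ≤ exp s n + (term s n + term s n)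
    exp-growth K≤n zero    = ≤-refl
    exp-growth {n} K≤n (suc m) = begin
      exp s (suc k) + (term s (suc k) + term s (suc k)) ≤⟨ +-mono-≤ (≤-reflexive (partialSum-suc (term s) k)) (term-halves (ℕ.≤-trans K≤n (ℕ.m≤n+m n m))) ⟩
      exp s k + term s k + term s k                     ≈⟨ +-assoc _ _ _ ⟩
      exp s k + (term s k + term s k)                   ≤⟨ exp-growth K≤n m ⟩
      exp s n + (term s n + term s n)                   ∎
      where k = m ℕ.+ n

    tail≤ : ∀ {n} → K ℕ.≤ n → exp s (n ℕ.+ n) - exp s n ≤ term s n + term s n
    tail≤ {n} K≤n = ≤-by (+-nonNeg (x≤y⇒0≤y-x (exp-growth K≤n n)) (+-nonNeg (0≤term (n ℕ.+ n)) (0≤term (n ℕ.+ n))))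
      (solve 4 (λ E E′ t t′ → t :+ t :- (E′ :- E) := E :+ (t :+ t) :- (E′ :+ (t′ :+ t′)) :+ (t′ :+ t′)) refl
        (exp s n) (exp s (n ℕ.+ n)) (term s n) (term s (n ℕ.+ n)))

    0≤tail : ∀ n → 0# ≤ exp s (n ℕ.+ n) - exp s n
    0≤tail n = ⊴-bound (partialSum-difference-⊴ {term s} (λ k → nonNeg-⊴ (0≤term k) ≤-refl) (ℕ.m≤m+n n n))

    term≤termK : ∀ m → term s (m ℕ.+ K) ≤ term s K
    term≤termK zero    = ≤-refl
    term≤termK (suc m) = ≤-trans (≤-by (0≤term (suc k)) (solve 1 (λ a → a :+ a :- a := a) refl (term s (suc k))))
      (≤-trans (term-halves (ℕ.m≤n+m K m)) (term≤termK m))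
      where k = m ℕ.+ K

    -- The recurrence turns n · t_n into s · t_(n-1). Decay of order 1/n suffices for a null tail
    -- and needs only the Archimedean property, no powers of 1/2.
    n*term≤ : ∀ {n} → K ℕ.< n → fromℕ n * term s n ≤ s * term s K
    n*term≤ {suc n} (s≤s K≤n) = ≤-trans (≤-reflexive (term-suc s n)) (*-monoˡ-≤ 0≤s
      (≡.subst (λ k → term s k ≤ term s K) (ℕ.m∸n+n≡m K≤n) (term≤termK (n ℕ.∸ K))))

    tail-null : Null (λ n → exp s (n ℕ.+ n) - exp s n)
    tail-null ε 0<ε none = archimedean (C / ε) λ (M , C/ε≤M) →
      none (suc K ℕ.⊔ M , λ n n≥ → nonNeg-⊴ (0≤tail n) (bound C/ε≤M (ℕ.≤-trans (ℕ.m≤m⊔n (suc K) M) n≥) (ℕ.≤-trans (ℕ.m≤n⊔m (suc K) M) n≥)))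
      where
      -- Beyond `K`, n times the tail is at most `C`; indices beyond C / ε therefore bring the tail
      -- below ε.
      C = s * term s K + s * term s K
      bound : ∀ {M n} → C / ε ≤ fromℕ M → K ℕ.< n → M ℕ.≤ n → exp s (n ℕ.+ n) - exp s n ≤ ε
      bound {M} {n} C/ε≤M K<n M≤n = ≤-trans (tail≤ (ℕ.<⇒≤ K<n))
        (*-cancelˡ-≤ (fromℕ-pos {n} (ℕ.≤-<-trans z≤n K<n)) (begin
          fromℕ n * (term s n + term s n)             ≈⟨ distribˡ _ _ _ ⟩
          fromℕ n * term s n + fromℕ n * term s n     ≤⟨ +-mono-≤ (n*term≤ K<n) (n*term≤ K<n) ⟩
          C                                           ≈⟨ y*[x/y]≈x 0<ε ⟨
          ε * (C / ε)                                 ≤⟨ *-monoˡ-≤ (<⇒≤ 0<ε) (≤-trans C/ε≤M (fromℕ-mono M≤n)) ⟩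
          ε * fromℕ n                                 ≈⟨ *-comm _ _ ⟩
          fromℕ n * ε                                 ∎))

  defect-null : ∀ x y → Null (defect x y)
  defect-null x y ε 0<ε none = archimedean (s + s) λ (K , 2s≤K) →
    null-dominated (always λ n → ⊴-trans (defect-⊴ (⊴-∣∣ x) (⊴-∣∣ y) n) (defect≤tail 0≤∣x∣ 0≤∣y∣ n))
      (Tail.tail-null (+-nonNeg 0≤∣x∣ 0≤∣y∣) {K} 2s≤K) ε 0<ε none
    where
    s = ∣ x ∣ + ∣ y ∣
    0≤∣x∣ = ⊴-bound (⊴-∣∣ x)
    0≤∣y∣ = ⊴-bound (⊴-∣∣ y)

  lim-suc : ∀ {u l} → Lim u l → Lim (u ∘ suc) l
  lim-suc h ε 0<ε none = h ε 0<ε λ (N , hN) → none (N , λ n n≥ → hN (suc n) (ℕ.m≤n⇒m≤1+n n≥))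

  lim-pos : ∀ {u l} → 0# < l → Lim u l → Eventually (λ n → 0# ≤ u n)
  lim-pos {u} {l} 0<l h = eventually (λ n p → ≤-by (x≤y⇒0≤y-x (proj₁ p))
    (solve 2 (λ u l → u :- :0 := u :- l :- :- l) refl (u n) l)) (h l 0<l)

  lim-null : ∀ {u} → Null u → Lim u 0#
  lim-null {u} = null-resp (λ n → solve 1 (λ a → a := a :- :0) refl (u n))

  lim-cong : ∀ {u v l m} → (∀ n → u n ≈ v n) → l ≈ m → Lim u l → Lim v m
  lim-cong p q = null-resp (λ n → +-cong (p n) (-‿cong q))

  exp-homo-+ : ∀ {x y a b} → Lim (exp x) a → Lim (exp y) b → Lim (exp (x + y)) (a * b)
  exp-homo-+ {x} {y} {a} {b} hx hy = lim-cong
    (λ n → solve 2 (λ p q → p :+ :- :1 :* (p :- q) := q) refl (exp x (suc n) * exp y n) (exp (x + y) n))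
    (solve 2 (λ a b → a :* b :+ :- :1 :* :0 := a :* b) refl a b)
    (lim-+ (lim-* (lim-suc hx) hy) (lim-* (lim-const (- 1#)) (lim-null (defect-null x y))))

  1+x≤exp : ∀ {x} → 0# ≤ x → ∀ n → 1# + x ≤ exp x (suc (suc n))
  1+x≤exp {x} 0≤x n = ≤-by (partialSum-nonNeg (λ k → term-nonNeg 0≤x (suc (suc k))) n)
    (trans (+-congʳ (+-cong (term-zero x) (+-congʳ term-one)))
      (solve 3 (λ o x t → o :+ (x :+ t) :- (o :+ x) := t) refl 1# x (partialSum (λ k → term x (suc (suc k))) n)))
    where
    term-one : term x 1 ≈ x
    term-one = begin-equality
      term x 1                   ≈⟨ solve 1 (λ t → t := (:1 :+ :0) :* t) refl (term x 1) ⟩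
      fromℕ 1 * term x 1         ≈⟨ term-suc x 0 ⟩
      x * term x 0               ≈⟨ *-congˡ (term-zero x) ⟩
      x * 1#                     ≈⟨ *-identityʳ x ⟩
      x                          ∎

  -- A form of exp x ≤ 1 / (1 - x) that remains valid for x ≥ 1. Adding the next term makes the
  -- induction work: since t_(n+1) ≤ x t_n, the strengthened left side never increases.
  [1-x]*exp≤1 : ∀ {x} → 0# ≤ x → ∀ n → (1# - x) * exp x n ≤ 1#
  [1-x]*exp≤1 {x} 0≤x n = ≤-trans (≤-by (term-nonNeg 0≤x n)
      (solve 2 (λ p t → p :+ t :- p := t) refl ((1# - x) * exp x n) (term x n))) (strengthened n)
    where
    term-suc≤ : ∀ n → term x (suc n) ≤ x * term x n
    term-suc≤ n = ≤-by (*-nonNeg (fromℕ-nonNeg n) (term-nonNeg 0≤x (suc n)))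
      (trans (+-congʳ (sym (term-suc x n)))
        (solve 2 (λ N t → (:1 :+ N) :* t :- t := N :* t) refl (fromℕ n) (term x (suc n))))

    strengthened : ∀ n → (1# - x) * exp x n + term x n ≤ 1#
    strengthened zero    = ≤-reflexive (trans (+-cong (zeroʳ _) (term-zero x)) (+-identityˡ 1#))
    strengthened (suc n) = begin
      (1# - x) * exp x (suc n) + term x (suc n)           ≤⟨ +-mono-≤ (≤-reflexive (*-congˡ (partialSum-suc (term x) n))) (term-suc≤ n) ⟩
      (1# - x) * (exp x n + term x n) + x * term x n      ≈⟨ solve 3 (λ x E t → (:1 :- x) :* (E :+ t) :+ x :* t := (:1 :- x) :* E :+ t) refl x (exp x n) (term x n) ⟩
      (1# - x) * exp x n + term x n                       ≤⟨ strengthened n ⟩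
      1#                                                  ∎

  exp-cong : ∀ {x y} → x ≈ y → ∀ n → exp x n ≈ exp y n
  exp-cong x≈y = partialSum-cong (term-cong x≈y)

  -- The graph of exp lies above its tangent at x. The case split keeps the increment nonnegative,
  -- because at negative arguments partial sums can fall below 1 + x; in the second case the bound
  -- on (1 - v) exp v is multiplied by exp y.
  exp-tangent : ∀ {x y a b} → 0# < a → 0# < b → Lim (exp x) a → Lim (exp y) b → a * (1# + (y - x)) ≤ b
  exp-tangent {x} {y} {a} {b} 0<a 0<b hx hy with ≤-total x y
  ... | inj₁ x≤y = lim-≤
    (eventually₂ (λ n p q → begin
        exp x (suc n) * (1# + h)                        ≤⟨ *-monoˡ-≤ p q ⟩
        exp x (suc n) * exp h n                         ≈⟨ solve 2 (λ p q → p := q :+ (p :- q)) refl (exp x (suc n) * exp h n) (exp (x + h) n) ⟩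
        exp (x + h) n + defect x h n                    ≈⟨ +-congʳ (exp-cong (solve 2 (λ x y → x :+ (y :- x) := y) refl x y) n) ⟩
        exp y n + defect x h n                          ∎)
      (lim-pos 0<a (lim-suc hx))
      (λ none → none (2 , λ { (suc (suc n)) _ → 1+x≤exp (x≤y⇒0≤y-x x≤y) n
                            ; (suc zero) (s≤s ()) })))
    (lim-* (lim-suc hx) (lim-const (1# + h)))
    (lim-cong (λ _ → refl) (+-identityʳ b) (lim-+ hy (lim-null (defect-null x h))))
    where h = y - x
  ... | inj₂ y≤x = ≤-resp (solve 3 (λ a x y → a :* (:1 :- (x :- y)) := a :* (:1 :+ (y :- x))) refl a x y) refl (lim-≤
    (eventually (λ n p → begin
        exp x n * (1# - v)
          ≈⟨ *-congʳ (exp-cong (solve 2 (λ x y → x := x :- y :+ y) refl x y) n) ⟩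
        exp (v + y) n * (1# - v)
          ≈⟨ solve 3 (λ p q u → q :* u := u :* p :+ :- u :* (p :- q)) refl (exp v (suc n) * exp y n) (exp (v + y) n) (1# - v) ⟩
        (1# - v) * (exp v (suc n) * exp y n) + - (1# - v) * defect v y n
          ≈⟨ +-congʳ (*-assoc _ _ _) ⟨
        (1# - v) * exp v (suc n) * exp y n + - (1# - v) * defect v y n
          ≤⟨ +-monoˡ-≤ _ (*-monoʳ-≤ p ([1-x]*exp≤1 (x≤y⇒0≤y-x y≤x) (suc n))) ⟩
        1# * exp y n + - (1# - v) * defect v y n
          ≈⟨ +-congʳ (*-identityˡ _) ⟩
        exp y n + - (1# - v) * defect v y n ∎)
      (lim-pos 0<b hy))
    (lim-* hx (lim-const (1# - v)))
    (lim-cong (λ _ → refl) (+-identityʳ b) (lim-+ hy (lim-null (null-scale (- (1# - v)) (defect-null v y))))))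
    where v = x - y

-- The logarithm, characterised by limits of exponential sums.

module Logarithm {c ℓ₁ ℓ₂} (ℝ : CompleteOrderedField c ℓ₁ ℓ₂) (log : NaturalLogarithm ℝ) where
  open OrderedField ℝ
  open Exponential ℝ
  open NaturalLogarithm log

  -- Junk value 0# outside the positive reals.
  Ln : Carrier → Carrier
  Ln x with 0# <? x
  ... | yes 0<x = ln x 0<x
  ... | no  _   = 0#

  Ln≈ln : ∀ {x} (0<x : 0# < x) → Ln x ≈ ln x 0<x
  Ln≈ln {x} 0<x with 0# <? x
  ... | yes p  = ln-cong p 0<x refl
  ... | no  ≮x = contradiction 0<x ≮x

  Ln-cong : ∀ {x y} → x ≈ y → Ln x ≈ Ln y
  Ln-cong {x} {y} x≈y with 0# <? x | 0# <? y
  ... | yes p | yes q = ln-cong p q x≈y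
  ... | yes p | no ¬q = contradiction (<-resp refl x≈y p) ¬q
  ... | no ¬p | yes q = contradiction (<-resp refl (sym x≈y) q) ¬p
  ... | no _  | no _  = refl

  xlnx≈ : ∀ x → xlnx ℝ log x ≈ x * Ln x
  xlnx≈ x with 0# <? x
  ... | yes _ = refl
  ... | no  _ = sym (zeroʳ x)

  exp-Ln : ∀ {x} → 0# < x → Lim (exp (Ln x)) x
  exp-Ln {x} 0<x = lim-cong (exp-cong (sym (Ln≈ln 0<x))) refl λ ε 0<ε none →
    let N , hN = exp-ln x 0<x ε 0<ε in none (N , λ n n≥ → let l , u = hN n n≥; a = exp (ln x 0<x) n in
      ≤-by (x≤y⇒0≤y-x (<⇒≤ l)) (solve 3 (λ e x a → a :- x :- :- e := a :- (x :- e)) refl ε x a) ,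
      ≤-by (x≤y⇒0≤y-x (<⇒≤ u)) (solve 3 (λ e x a → e :- (a :- x) := x :+ e :- a) refl ε x a))

  -- The tangent inequality of exp between `Ln a` and `Ln b`; it is ln u ≤ u - 1 at u = b / a,
  -- without the division.
  Ln-tangent : ∀ {a b} → 0# < a → 0# < b → a * (Ln b - Ln a) ≤ b - a
  Ln-tangent {a} {b} 0<a 0<b = ≤-by (x≤y⇒0≤y-x (exp-tangent 0<a 0<b (exp-Ln 0<a) (exp-Ln 0<b)))
    (solve 4 (λ a b x y → b :- a :- a :* (y :- x) := b :- a :* (:1 :+ (y :- x))) refl a b (Ln a) (Ln b))

  Ln-cancel-≤ : ∀ {a b} → 0# < a → 0# < b → Ln a ≤ Ln b → a ≤ b
  Ln-cancel-≤ 0<a 0<b h = ≤-by (≤-trans (*-nonNeg (<⇒≤ 0<a) (x≤y⇒0≤y-x h)) (Ln-tangent 0<a 0<b)) refl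

  -- Both sides are exponents of `a * b`, and the tangent inequality used in both directions makes
  -- the exponent unique.
  Ln-* : ∀ {a b} → 0# < a → 0# < b → Ln (a * b) ≈ Ln a + Ln b
  Ln-* {a} {b} 0<a 0<b = antisym (compare hs hp) (compare hp hs)
    where
    hp = exp-Ln (*-pos 0<a 0<b)
    hs = exp-homo-+ (exp-Ln 0<a) (exp-Ln 0<b)

    compare : ∀ {x y} → Lim (exp x) (a * b) → Lim (exp y) (a * b) → y ≤ x
    compare {x} {y} hx hy = *-cancelˡ-≤ (*-pos 0<a 0<b) (≤-by (x≤y⇒0≤y-x (exp-tangent (*-pos 0<a 0<b) (*-pos 0<a 0<b) hx hy))
      (solve 3 (λ p x y → p :* x :- p :* y := p :- p :* (:1 :+ (y :- x))) refl (a * b) x y))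

-- Finite sums and differences of unit vectors.

module FiniteSums {c ℓ₁ ℓ₂} (ℝ : CompleteOrderedField c ℓ₁ ℓ₂) where
  open OrderedField ℝ
  open SemiringSum semiring public using (sum-cong-≋; *-distribˡ-sum; ∑-distrib-+)

  sum-mono : ∀ {n} {u v : Vector Carrier n} → (∀ i → u i ≤ v i) → sum u ≤ sum v
  sum-mono {zero}  h = ≤-refl
  sum-mono {suc n} h = +-mono-≤ (h zero) (sum-mono λ i → h (suc i))

  indicator : ∀ {n} → Fin n → Vector Carrier n
  indicator zero    zero    = 1#
  indicator zero    (suc p) = 0#
  indicator (suc i) zero    = 0#
  indicator (suc i) (suc p) = indicator i p

  indicator-refl : ∀ {n} (i : Fin n) → indicator i i ≡ 1#
  indicator-refl zero    = ≡.refl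
  indicator-refl (suc i) = indicator-refl i

  indicator-≢ : ∀ {n} {i p : Fin n} → p ≢ i → indicator i p ≡ 0#
  indicator-≢ {i = zero}  {zero}  p≢i = contradiction ≡.refl p≢i
  indicator-≢ {i = zero}  {suc p} p≢i = ≡.refl
  indicator-≢ {i = suc i} {zero}  p≢i = ≡.refl
  indicator-≢ {i = suc i} {suc p} p≢i = indicator-≢ λ p≡i → p≢i (≡.cong suc p≡i)

  sum-0* : ∀ {n} (u : Vector Carrier n) → sum (λ p → 0# * u p) ≈ 0#
  sum-0* u = trans (sym (*-distribˡ-sum 0# u)) (zeroˡ _)

  sum-indicator : ∀ {n} (i : Fin n) (u : Vector Carrier n) → sum (λ p → indicator i p * u p) ≈ u i
  sum-indicator zero    u = trans (+-cong (*-identityˡ _) (sum-0* λ p → u (suc p))) (+-identityʳ _)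
  sum-indicator (suc i) u = trans (+-cong (zeroˡ _) (sum-indicator i λ p → u (suc p))) (+-identityˡ _)

  -- The vector e_i - e_k. A 2 × 2 move is the outer product of two such vectors, so sums against it
  -- factor.
  signed : ∀ {n} → Fin n → Fin n → Vector Carrier n
  signed i k p = indicator i p - indicator k p

  sum-signed : ∀ {n} (i k : Fin n) (u : Vector Carrier n) → sum (λ p → signed i k p * u p) ≈ u i - u k
  sum-signed i k u = begin-equality
    sum (λ p → signed i k p * u p)
      ≈⟨ sum-cong-≋ (λ p → solve 3 (λ a b u → (a :- b) :* u := a :* u :+ :- :1 :* (b :* u)) refl (indicator i p) (indicator k p) (u p)) ⟩
    sum (λ p → indicator i p * u p + - 1# * (indicator k p * u p))
      ≈⟨ ∑-distrib-+ (λ p → indicator i p * u p) (λ p → - 1# * (indicator k p * u p)) ⟩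
    sum (λ p → indicator i p * u p) + sum (λ p → - 1# * (indicator k p * u p))
      ≈⟨ +-cong (sum-indicator i u) (trans (sym (*-distribˡ-sum (- 1#) (λ p → indicator k p * u p))) (*-congˡ (sum-indicator k u))) ⟩
    u i + - 1# * u k
      ≈⟨ solve 2 (λ a b → a :+ :- :1 :* b := a :- b) refl (u i) (u k) ⟩
    u i - u k ∎

  sum-signed≈0 : ∀ {n} (i k : Fin n) → sum (signed i k) ≈ 0#
  sum-signed≈0 i k = trans (sum-cong-≋ (λ p → sym (*-identityʳ (signed i k p))))
    (trans (sum-signed i k (λ _ → 1#)) (-‿inverseʳ 1#))

  data SignedView {n} (i k : Fin n) (p : Fin n) : Set ℓ₁ where
    at-plus  : p ≡ i → signed i k p ≈ 1# → SignedView i k p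
    at-minus : p ≡ k → signed i k p ≈ - 1# → SignedView i k p
    off      : signed i k p ≈ 0# → SignedView i k p

  signed-i : ∀ {n} {i k : Fin n} → i ≢ k → signed i k i ≈ 1#
  signed-i {i = i} {k} i≢k = trans (+-cong (reflexive (indicator-refl i)) (-‿cong (reflexive (indicator-≢ i≢k))))
    (solve 0 (:1 :- :0 := :1) refl)

  signed-k : ∀ {n} {i k : Fin n} → i ≢ k → signed i k k ≈ - 1#
  signed-k {i = i} {k} i≢k = trans (+-cong (reflexive (indicator-≢ λ k≡i → i≢k (≡.sym k≡i))) (-‿cong (reflexive (indicator-refl k))))
    (+-identityˡ _)

  signedView : ∀ {n} {i k : Fin n} → i ≢ k → ∀ p → SignedView i k p
  signedView {i = i} {k} i≢k p with p Fin.≟ i | p Fin.≟ k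
  ... | yes ≡.refl | _          = at-plus ≡.refl (signed-i i≢k)
  ... | no _       | yes ≡.refl = at-minus ≡.refl (signed-k i≢k)
  ... | no p≢i     | no p≢k     = off (trans (+-cong (reflexive (indicator-≢ p≢i)) (-‿cong (reflexive (indicator-≢ p≢k)))) (-‿inverseʳ 0#))

-- Perturbing the typical table: the 2 × 2 minor relation.

module Optimality {c ℓ₁ ℓ₂} (ℝ : CompleteOrderedField c ℓ₁ ℓ₂) (log : NaturalLogarithm ℝ) where
  open OrderedField ℝ
  open FiniteSums ℝ
  open Logarithm ℝ log

  entropy : Carrier → Carrier
  entropy x = (x + 1#) * Ln (x + 1#) - x * Ln x

  entropy-cong : ∀ {x y} → x ≈ y → entropy x ≈ entropy y
  entropy-cong e = +-cong (*-cong (+-congʳ e) (Ln-cong (+-congʳ e))) (-‿cong (*-cong e (Ln-cong e)))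

  g≈sum-entropy : ∀ {m n} (X : Matrix ℝ m n) → g ℝ log X ≈ sum (λ i → sum (λ j → entropy (X i j)))
  g≈sum-entropy X = sum-cong-≋ λ i → sum-cong-≋ λ j → +-cong (xlnx≈ (X i j + 1#)) (-‿cong (xlnx≈ (X i j)))

  -- The derivative of `entropy` on the positive reals.
  entropy′ : Carrier → Carrier
  entropy′ x = Ln (x + 1#) - Ln x

  entropy′-cong : ∀ {x y} → x ≈ y → entropy′ x ≈ entropy′ y
  entropy′-cong e = +-cong (Ln-cong (+-congʳ e)) (-‿cong (Ln-cong e))

  0<x+1 : ∀ {x} → 0# ≤ x → 0# < x + 1#
  0<x+1 0≤x = +-nonNeg-pos 0≤x 0<1

  -- The gap between the two sides is x ln(A/B) + ln((z+1)/(x+1)) with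
  -- A = x(z+1) and B = z(x+1); the tangent bounds for the two logarithms cancel.
  entropy-tangent : ∀ {x z} → 0# ≤ x → 0# < z → entropy x ≤ entropy z + (x - z) * entropy′ z
  entropy-tangent {x} {z} 0≤x 0<z = ≤-by (*-cancel-nonNeg 0<z+1 (≤-resp refl
    (solve 6 (λ x z Lx Lz Lx1 Lz1 →
        (z :- x) :- x :* (z :+ :1) :* (Lz :+ Lx1 :- (Lx :+ Lz1)) :+ (x :+ :1 :- (z :+ :1) :- (z :+ :1) :* (Lx1 :- Lz1))
        := (z :+ :1) :* ((z :+ :1) :* Lz1 :- z :* Lz :+ (x :- z) :* (Lz1 :- Lz) :- ((x :+ :1) :* Lx1 :- x :* Lx)))
      refl x z (Ln x) (Ln z) (Ln (x + 1#)) (Ln (z + 1#)))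
    (+-nonNeg (x≤y⇒0≤y-x (ratio-bound (0# <? x))) (x≤y⇒0≤y-x (Ln-tangent 0<z+1 (0<x+1 0≤x)))))) refl
    where
    0<z+1 = 0<x+1 (<⇒≤ 0<z)

    ratio-bound : Dec (0# < x) → x * (z + 1#) * (Ln z + Ln (x + 1#) - (Ln x + Ln (z + 1#))) ≤ z - x
    ratio-bound (yes 0<x) = ≤-resp (*-congˡ (+-cong (Ln-* 0<z (0<x+1 0≤x)) (-‿cong (Ln-* 0<x 0<z+1))))
                      (solve 2 (λ x z → z :* (x :+ :1) :- x :* (z :+ :1) := z :- x) refl x z)
                      (Ln-tangent (*-pos 0<x 0<z+1) (*-pos 0<z (0<x+1 0≤x)))
    ratio-bound (no ≮x) = ≤-resp (sym (trans (*-congʳ (trans (*-congʳ x≈0) (zeroˡ _))) (zeroˡ _)))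
                    (sym (trans (+-congˡ (-‿cong x≈0)) (solve 1 (λ z → z :- :0 := z) refl z))) (<⇒≤ 0<z)
      where x≈0 = antisym (≮⇒≥ ≮x) 0≤x

  Ln-*₄ : ∀ {a b c d} → 0# < a → 0# < b → 0# < c → 0# < d →
          Ln (a * b * (c * d)) ≈ Ln a + Ln b + (Ln c + Ln d)
  Ln-*₄ 0<a 0<b 0<c 0<d = trans (Ln-* (*-pos 0<a 0<b) (*-pos 0<c 0<d)) (+-cong (Ln-* 0<a 0<b) (Ln-* 0<c 0<d))

  -- The hypothesis is the logarithm of u_a u_b ≤ u_c u_d. Clearing denominators gives a polynomial
  -- inequality, in which entries may afterwards tend to 0.
  entropy′-product : ∀ {a b c d} → 0# < a → 0# < b → 0# < c → 0# < d →
    entropy′ a + entropy′ b ≤ entropy′ c + entropy′ d →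
    (a + 1#) * (b + 1#) * (c * d) ≤ (c + 1#) * (d + 1#) * (a * b)
  entropy′-product {a} {b} {c} {d} 0<a 0<b 0<c 0<d h = Ln-cancel-≤
    (*-pos (*-pos 0<a+1 0<b+1) (*-pos 0<c 0<d))
    (*-pos (*-pos 0<c+1 0<d+1) (*-pos 0<a 0<b))
    (≤-resp (sym (Ln-*₄ 0<a+1 0<b+1 0<c 0<d)) (sym (Ln-*₄ 0<c+1 0<d+1 0<a 0<b)) (≤-by (x≤y⇒0≤y-x h)
      (solve 8 (λ a b c d a′ b′ c′ d′ → c′ :+ d′ :+ (a :+ b) :- (a′ :+ b′ :+ (c :+ d))
                  := c′ :- c :+ (d′ :- d) :- (a′ :- a :+ (b′ :- b))) refl
        (Ln a) (Ln b) (Ln c) (Ln d) (Ln (a + 1#)) (Ln (b + 1#)) (Ln (c + 1#)) (Ln (d + 1#)))))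
    where
    0<a+1 = 0<x+1 (<⇒≤ 0<a)
    0<b+1 = 0<x+1 (<⇒≤ 0<b)
    0<c+1 = 0<x+1 (<⇒≤ 0<c)
    0<d+1 = 0<x+1 (<⇒≤ 0<d)

  half< : ∀ {x} → 0# < x → half x < x
  half< {x} 0<x = 0<y-x⇒x<y (<-resp refl (trans (solve 1 (λ h → h := h :+ h :- h) refl (half x)) (+-congʳ (half+half x))) (half-pos 0<x))

  lesser : ∀ {x y} → 0# < x → 0# < y → ∃[ z ] 0# < z × z < x × z < y
  lesser {x} {y} 0<x 0<y with ≤-total x y
  ... | inj₁ x≤y = half x , half-pos 0<x , half< 0<x , <-≤-trans (half< 0<x) x≤y
  ... | inj₂ y≤x = half y , half-pos 0<y , <-≤-trans (half< 0<y) y≤x , half< 0<y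

  -- If A exceeded B, any δ below (A - B) / (1 + |M|) would make δ M smaller than the excess.
  ≤-by-small-perturbations : ∀ {η A B M} → 0# < η → (∀ δ → 0# < δ → δ < η → A ≤ B + δ * M) → A ≤ B
  ≤-by-small-perturbations {η} {A} {B} {M} 0<η h = ≤-stable λ A≰B →
    let 0<A-B = x<y⇒0<y-x (≰⇒> A≰B)
        δ , 0<δ , δ<η , δ<δ₀ = lesser 0<η (/-pos 0<A-B 0<a)
    in <⇒≱ (*-pos 0<a (x<y⇒0<y-x δ<δ₀)) (≤-by
         (+-nonNeg (x≤y⇒0≤y-x (h δ 0<δ δ<η)) (*-nonNeg (<⇒≤ 0<δ) (x≤y⇒0≤y-x M≤a)))
         (trans (+-congˡ (-‿cong (trans (solve 3 (λ a d d′ → a :* (d′ :- d) := a :* d′ :- a :* d) refl a δ ((A - B) / a))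
                                   (+-congʳ (y*[x/y]≈x 0<a)))))
           (solve 5 (λ a d M A B → :0 :- (A :- B :- a :* d) := B :+ d :* M :- A :+ d :* (a :- M)) refl a δ M A B)))
    where
    a = 1# + ∣ M ∣
    0<a : 0# < a
    0<a = +-pos-nonNeg 0<1 (⊴-bound (⊴-∣∣ M))
    M≤a : M ≤ a
    M≤a = ≤-trans (proj₂ (⊴-∣∣ M)) (≤-by 0≤1 (solve 2 (λ o y → o :+ y :- y := o) refl 1# ∣ M ∣))

  -- Continuity at δ = 0 with an explicit error: δ is dropped from the factors of the form z + 1 by
  -- monotonicity, and expanding the others leaves an error linear in δ. Restricting to δ ≤ 1
  -- absorbs δ² into δ.
  cross-limit : ∀ {x₁ x₂ y₁ y₂} → 0# ≤ x₁ → 0# ≤ x₂ → 0# < y₁ → 0# < y₂ →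
    (∀ δ → 0# < δ → δ < y₁ → δ < y₂ →
      (x₁ + δ + 1#) * (x₂ + δ + 1#) * ((y₁ - δ) * (y₂ - δ)) ≤ (y₁ - δ + 1#) * (y₂ - δ + 1#) * ((x₁ + δ) * (x₂ + δ))) →
    (x₁ + 1#) * (x₂ + 1#) * (y₁ * y₂) ≤ (y₁ + 1#) * (y₂ + 1#) * (x₁ * x₂)
  cross-limit {x₁} {x₂} {y₁} {y₂} 0≤x₁ 0≤x₂ 0<y₁ 0<y₂ h =
    let η₁ , 0<η₁ , η₁<y₁ , η₁<y₂ = lesser 0<y₁ 0<y₂
        η , 0<η , η<η₁ , η<1 = lesser 0<η₁ 0<1
        below : ∀ {δ z} → δ < η → η₁ < z → δ < z
        below δ<η η₁<z = <-≤-trans δ<η (≤-trans (<⇒≤ η<η₁) (<⇒≤ η₁<z))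
    in ≤-by-small-perturbations 0<η λ δ 0<δ δ<η →
      bound δ (<⇒≤ 0<δ) (<⇒≤ (<-≤-trans δ<η (<⇒≤ η<1))) (below δ<η η₁<y₁) (below δ<η η₁<y₂) (h δ 0<δ (below δ<η η₁<y₁) (below δ<η η₁<y₂))
    where
    bound : ∀ δ → 0# ≤ δ → δ ≤ 1# → δ < y₁ → δ < y₂ →
      (x₁ + δ + 1#) * (x₂ + δ + 1#) * ((y₁ - δ) * (y₂ - δ)) ≤ (y₁ - δ + 1#) * (y₂ - δ + 1#) * ((x₁ + δ) * (x₂ + δ)) →
      (x₁ + 1#) * (x₂ + 1#) * (y₁ * y₂)
        ≤ (y₁ + 1#) * (y₂ + 1#) * (x₁ * x₂) + δ * ((x₁ + 1#) * (x₂ + 1#) * (y₁ + y₂) + (y₁ + 1#) * (y₂ + 1#) * (x₁ + x₂ + 1#))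
    bound δ 0≤δ δ≤1 δ<y₁ δ<y₂ p = ≤-by
      (+-nonNeg (+-nonNeg (x≤y⇒0≤y-x p₁) (x≤y⇒0≤y-x p)) (+-nonNeg (x≤y⇒0≤y-x p₂)
        (+-nonNeg (*-nonNeg (*-nonNeg X₁ X₂) (*-nonNeg 0≤δ 0≤δ)) (*-nonNeg (*-nonNeg Y₁ Y₂) (*-nonNeg 0≤δ (x≤y⇒0≤y-x δ≤1))))))
      (solve 7 (λ x₁ x₂ y₁ y₂ d L U →
          (y₁ :+ :1) :* (y₂ :+ :1) :* (x₁ :* x₂) :+ d :* ((x₁ :+ :1) :* (x₂ :+ :1) :* (y₁ :+ y₂) :+ (y₁ :+ :1) :* (y₂ :+ :1) :* (x₁ :+ x₂ :+ :1))
            :- (x₁ :+ :1) :* (x₂ :+ :1) :* (y₁ :* y₂)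
          := L :- (x₁ :+ :1) :* (x₂ :+ :1) :* ((y₁ :- d) :* (y₂ :- d)) :+ (U :- L)
             :+ ((y₁ :+ :1) :* (y₂ :+ :1) :* ((x₁ :+ d) :* (x₂ :+ d)) :- U
             :+ ((x₁ :+ :1) :* (x₂ :+ :1) :* (d :* d) :+ (y₁ :+ :1) :* (y₂ :+ :1) :* (d :* (:1 :- d)))))
        refl x₁ x₂ y₁ y₂ δ _ _)
      where
      X₁ = <⇒≤ (0<x+1 0≤x₁)
      X₂ = <⇒≤ (0<x+1 0≤x₂)
      Y₁ = <⇒≤ (0<x+1 (<⇒≤ 0<y₁))
      Y₂ = <⇒≤ (0<x+1 (<⇒≤ 0<y₂))
      δ≤y₁ = x≤y⇒0≤y-x (<⇒≤ δ<y₁)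
      δ≤y₂ = x≤y⇒0≤y-x (<⇒≤ δ<y₂)

      grow : ∀ x → x + 1# ≤ x + δ + 1#
      grow x = ≤-by 0≤δ (solve 2 (λ x d → x :+ d :+ :1 :- (x :+ :1) := d) refl x δ)

      shrink : ∀ y → y - δ + 1# ≤ y + 1#
      shrink y = ≤-by 0≤δ (solve 2 (λ y d → y :+ :1 :- (y :- d :+ :1) := d) refl y δ)

      p₁ : (x₁ + 1#) * (x₂ + 1#) * ((y₁ - δ) * (y₂ - δ)) ≤ (x₁ + δ + 1#) * (x₂ + δ + 1#) * ((y₁ - δ) * (y₂ - δ))
      p₁ = *-monoʳ-≤ (*-nonNeg δ≤y₁ δ≤y₂) (*-mono-≤ X₂ (≤-trans X₁ (grow x₁)) (grow x₁) (grow x₂))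

      p₂ : (y₁ - δ + 1#) * (y₂ - δ + 1#) * ((x₁ + δ) * (x₂ + δ)) ≤ (y₁ + 1#) * (y₂ + 1#) * ((x₁ + δ) * (x₂ + δ))
      p₂ = *-monoʳ-≤ (*-nonNeg (+-nonNeg 0≤x₁ 0≤δ) (+-nonNeg 0≤x₂ 0≤δ)) (*-mono-≤ (<⇒≤ (0<x+1 δ≤y₂)) Y₁ (shrink y₁) (shrink y₂))

  module _ {m n} {R : Vector ℕ m} {C : Vector ℕ n} {X : Matrix ℝ m n} (X* : IsTypicalTable ℝ log R C X) where
    open IsTypicalTable X*
    open TransportationPolytope feasible

    module Perturbation {i k : Fin m} {j l : Fin n} (i≢k : i ≢ k) (j≢l : j ≢ l)
                        {δ} (0<δ : 0# < δ) (δ<Xil : δ < X i l) (δ<Xkj : δ < X k j) where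
      s = signed i k
      t = signed j l

      Y : Matrix ℝ m n
      Y p q = X p q + δ * (s p * t q)

      entry : ∀ {p q a b} → s p ≈ a → t q ≈ b → Y p q ≈ X p q + δ * (a * b)
      entry e e′ = +-congˡ (*-congˡ (*-cong e e′))

      Yij : Y i j ≈ X i j + δ
      Yij = trans (entry (signed-i i≢k) (signed-i j≢l)) (solve 2 (λ x d → x :+ d :* (:1 :* :1) := x :+ d) refl _ δ)

      Ykl : Y k l ≈ X k l + δ
      Ykl = trans (entry (signed-k i≢k) (signed-k j≢l)) (solve 2 (λ x d → x :+ d :* (:- :1 :* :- :1) := x :+ d) refl _ δ)

      Yil : Y i l ≈ X i l - δ
      Yil = trans (entry (signed-i i≢k) (signed-k j≢l)) (solve 2 (λ x d → x :+ d :* (:1 :* :- :1) := x :- d) refl _ δ)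

      Ykj : Y k j ≈ X k j - δ
      Ykj = trans (entry (signed-k i≢k) (signed-i j≢l)) (solve 2 (λ x d → x :+ d :* (:- :1 :* :1) := x :- d) refl _ δ)

      0<Yij : 0# < Y i j
      0<Yij = <-resp refl (sym Yij) (+-nonNeg-pos (nonNegative i j) 0<δ)

      0<Ykl : 0# < Y k l
      0<Ykl = <-resp refl (sym Ykl) (+-nonNeg-pos (nonNegative k l) 0<δ)

      0<Yil : 0# < Y i l
      0<Yil = <-resp refl (sym Yil) (x<y⇒0<y-x δ<Xil)

      0<Ykj : 0# < Y k j
      0<Ykj = <-resp refl (sym Ykj) (x<y⇒0<y-x δ<Xkj)

      -- The tangent inequality needs a positive base point. An entry of `Y` that may vanish is one
      -- that did not move, and there no inequality is required.
      unchanged-or-pos : ∀ p q → (s p * t q ≈ 0#) ⊎ (0# < Y p q)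
      unchanged-or-pos p q with signedView i≢k p | signedView j≢l q
      ... | off e             | _                 = inj₁ (trans (*-congʳ e) (zeroˡ _))
      ... | _                 | off e             = inj₁ (trans (*-congˡ e) (zeroʳ _))
      ... | at-plus ≡.refl _  | at-plus ≡.refl _  = inj₂ 0<Yij
      ... | at-plus ≡.refl _  | at-minus ≡.refl _ = inj₂ 0<Yil
      ... | at-minus ≡.refl _ | at-plus ≡.refl _  = inj₂ 0<Ykj
      ... | at-minus ≡.refl _ | at-minus ≡.refl _ = inj₂ 0<Ykl

      unchanged : ∀ {p q} → s p * t q ≈ 0# → Y p q ≈ X p q
      unchanged e = trans (+-congˡ (trans (*-congˡ e) (zeroʳ δ))) (+-identityʳ _)

      Y-feasible : TransportationPolytope ℝ R C Y
      Y-feasible = record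
        { nonNegative = λ p q → nonNeg p q (unchanged-or-pos p q)
        ; rowSums     = λ p → trans (∑-distrib-+ (X p) (λ q → δ * (s p * t q))) (trans (+-cong (rowSums p) (begin-equality
            sum (λ q → δ * (s p * t q))   ≈⟨ *-distribˡ-sum δ (λ q → s p * t q) ⟨
            δ * sum (λ q → s p * t q)     ≈⟨ *-congˡ (*-distribˡ-sum (s p) t) ⟨
            δ * (s p * sum t)             ≈⟨ *-congˡ (*-congˡ (sum-signed≈0 j l)) ⟩
            δ * (s p * 0#)                ≈⟨ solve 2 (λ d s → d :* (s :* :0) := :0) refl δ (s p) ⟩
            0#                            ∎)) (+-identityʳ _))
        ; columnSums  = λ q → trans (∑-distrib-+ (λ p → X p q) (λ p → δ * (s p * t q))) (trans (+-cong (columnSums q) (begin-equality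
            sum (λ p → δ * (s p * t q))   ≈⟨ *-distribˡ-sum δ (λ p → s p * t q) ⟨
            δ * sum (λ p → s p * t q)     ≈⟨ *-congˡ (sum-signed i k (λ _ → t q)) ⟩
            δ * (t q - t q)               ≈⟨ solve 2 (λ d s → d :* (s :- s) := :0) refl δ (t q) ⟩
            0#                            ∎)) (+-identityʳ _))
        }
        where
        nonNeg : ∀ p q → (s p * t q ≈ 0#) ⊎ (0# < Y p q) → 0# ≤ Y p q
        nonNeg p q (inj₁ e)   = ≤-resp refl (sym (unchanged e)) (nonNegative p q)
        nonNeg p q (inj₂ 0<Y) = <⇒≤ 0<Y

      w : Matrix ℝ m n
      w p q = entropy′ (Y p q)

      entropy-increase : ∀ p q → entropy (X p q) + δ * (s p * (t q * w p q)) ≤ entropy (Y p q)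
      entropy-increase p q with unchanged-or-pos p q
      ... | inj₁ e = ≤-reflexive (begin-equality
        entropy (X p q) + δ * (s p * (t q * w p q))   ≈⟨ +-congˡ (solve 4 (λ d s t w → d :* (s :* (t :* w)) := s :* t :* (d :* w)) refl δ (s p) (t q) (w p q)) ⟩
        entropy (X p q) + s p * t q * (δ * w p q)     ≈⟨ +-congˡ (trans (*-congʳ e) (zeroˡ _)) ⟩
        entropy (X p q) + 0#                          ≈⟨ +-identityʳ _ ⟩
        entropy (X p q)                               ≈⟨ entropy-cong (unchanged e) ⟨
        entropy (Y p q)                               ∎)
      ... | inj₂ 0<Y = ≤-by (x≤y⇒0≤y-x (entropy-tangent (nonNegative p q) 0<Y))
        (solve 7 (λ E F x d s t w → F :- (E :+ d :* (s :* (t :* w))) := F :+ (x :- (x :+ d :* (s :* t))) :* w :- E) refl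
          (entropy (X p q)) (entropy (Y p q)) (X p q) δ (s p) (t q) (w p q))

      directional-derivative : sum (λ p → sum (λ q → s p * (t q * w p q))) ≈ w i j - w i l - (w k j - w k l)
      directional-derivative = begin-equality
        sum (λ p → sum (λ q → s p * (t q * w p q)))   ≈⟨ sum-cong-≋ (λ p → *-distribˡ-sum (s p) (λ q → t q * w p q)) ⟨
        sum (λ p → s p * sum (λ q → t q * w p q))     ≈⟨ sum-cong-≋ (λ p → *-congˡ (sum-signed j l (w p))) ⟩
        sum (λ p → s p * (w p j - w p l))             ≈⟨ sum-signed i k (λ p → w p j - w p l) ⟩
        w i j - w i l - (w k j - w k l)               ∎

      -- With D the derivative of g at `Y` along the move, concavity gives g X + δ D ≤ g Y, and
      -- maximality gives g Y ≤ g X; hence D ≤ 0.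
      first-order : entropy′ (X i j + δ) + entropy′ (X k l + δ) ≤ entropy′ (X i l - δ) + entropy′ (X k j - δ)
      first-order = ≤-resp (+-cong (entropy′-cong Yij) (entropy′-cong Ykl)) (+-cong (entropy′-cong Yil) (entropy′-cong Ykj))
        (≤-by (*-cancel-nonNeg 0<δ (≤-by (x≤y⇒0≤y-x g+δD≤g)
            (solve 6 (λ G d a b c e → d :* (:0 :- (a :- b :- (c :- e))) :- :0 := G :- (G :+ d :* (a :- b :- (c :- e)))) refl
              (g ℝ log X) δ (w i j) (w i l) (w k j) (w k l))))
          (solve 4 (λ a b c e → b :+ c :- (a :+ e) := :0 :- (a :- b :- (c :- e))) refl (w i j) (w i l) (w k j) (w k l)))
        where
        g+δD≤g : g ℝ log X + δ * (w i j - w i l - (w k j - w k l)) ≤ g ℝ log X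
        g+δD≤g = begin
          g ℝ log X + δ * (w i j - w i l - (w k j - w k l))
            ≈⟨ +-cong (g≈sum-entropy X) (*-congˡ (sym directional-derivative)) ⟩
          sum (λ p → sum (λ q → entropy (X p q))) + δ * sum (λ p → sum (λ q → s p * (t q * w p q)))
            ≈⟨ +-congˡ (trans (*-distribˡ-sum δ (λ p → sum (λ q → s p * (t q * w p q))))
                 (sum-cong-≋ λ p → *-distribˡ-sum δ (λ q → s p * (t q * w p q)))) ⟩
          sum (λ p → sum (λ q → entropy (X p q))) + sum (λ p → sum (λ q → δ * (s p * (t q * w p q))))
            ≈⟨ ∑-distrib-+ (λ p → sum (λ q → entropy (X p q))) (λ p → sum (λ q → δ * (s p * (t q * w p q)))) ⟨
          sum (λ p → sum (λ q → entropy (X p q)) + sum (λ q → δ * (s p * (t q * w p q))))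
            ≈⟨ sum-cong-≋ (λ p → ∑-distrib-+ (λ q → entropy (X p q)) (λ q → δ * (s p * (t q * w p q)))) ⟨
          sum (λ p → sum (λ q → entropy (X p q) + δ * (s p * (t q * w p q))))
            ≤⟨ sum-mono (λ p → sum-mono (λ q → entropy-increase p q)) ⟩
          sum (λ p → sum (λ q → entropy (Y p q)))
            ≈⟨ g≈sum-entropy Y ⟨
          g ℝ log Y
            ≤⟨ maximal Y Y-feasible ⟩
          g ℝ log X ∎

    cross-ratio-vanishing : ∀ {i k j l} → X i l * X k j ≈ 0# → (X i j + 1#) * (X k l + 1#) * (X i l * X k j) ≤ (X i l + 1#) * (X k j + 1#) * (X i j * X k l)
    cross-ratio-vanishing {i} {k} {j} {l} e = ≤-trans (≤-reflexive (trans (*-congˡ e) (zeroʳ _)))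
      (*-nonNeg (*-nonNeg (<⇒≤ (0<x+1 (nonNegative i l))) (<⇒≤ (0<x+1 (nonNegative k j)))) (*-nonNeg (nonNegative i j) (nonNegative k l)))

    -- Exchanging `j` and `l` reverses the inequality, so it amounts to the equality of both sides.
    -- If `X i l` or `X k j` is 0, no mass can be moved, but then the left side vanishes.
    cross-ratio : ∀ i k j l → (X i j + 1#) * (X k l + 1#) * (X i l * X k j) ≤ (X i l + 1#) * (X k j + 1#) * (X i j * X k l)
    cross-ratio i k j l with i Fin.≟ k | j Fin.≟ l | 0# <? X i l | 0# <? X k j
    ... | yes ≡.refl | _ | _ | _ = ≤-reflexive (*-cong (*-comm _ _) (*-comm _ _))
    ... | _ | yes ≡.refl | _ | _ = ≤-refl
    ... | no i≢k | no j≢l | yes 0<Xil | yes 0<Xkj =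
      cross-limit (nonNegative i j) (nonNegative k l) 0<Xil 0<Xkj λ δ 0<δ δ<Xil δ<Xkj →
        entropy′-product (+-nonNeg-pos (nonNegative i j) 0<δ) (+-nonNeg-pos (nonNegative k l) 0<δ)
          (x<y⇒0<y-x δ<Xil) (x<y⇒0<y-x δ<Xkj) (Perturbation.first-order i≢k j≢l 0<δ δ<Xil δ<Xkj)
    ... | no _ | no _ | no ≮Xil | _ = cross-ratio-vanishing (trans (*-congʳ (antisym (≮⇒≥ ≮Xil) (nonNegative i l))) (zeroˡ _))
    ... | no _ | no _ | yes _ | no ≮Xkj = cross-ratio-vanishing (trans (*-congˡ (antisym (≮⇒≥ ≮Xkj) (nonNegative k j))) (zeroʳ _))

-- Entries of an integer vector against its maximum and minimum.

lookup≤foldr-⊔ : ∀ {n} a (v : Vector ℕ n) i → v i ℕ.≤ foldr ℕ._⊔_ a v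
lookup≤foldr-⊔ a v zero    = ℕ.m≤m⊔n _ _
lookup≤foldr-⊔ a v (suc i) = ℕ.≤-trans (lookup≤foldr-⊔ a (tail v) i) (ℕ.m≤n⊔m _ _)

base≤foldr-⊔ : ∀ {n} a (v : Vector ℕ n) → a ℕ.≤ foldr ℕ._⊔_ a v
base≤foldr-⊔ {zero}  a v = ℕ.≤-refl
base≤foldr-⊔ {suc n} a v = ℕ.≤-trans (base≤foldr-⊔ a (tail v)) (ℕ.m≤n⊔m _ _)

lookup≤maximum : ∀ {n} (v : Vector ℕ (suc n)) i → v i ℕ.≤ maximum v
lookup≤maximum v zero    = base≤foldr-⊔ (head v) (tail v)
lookup≤maximum v (suc i) = lookup≤foldr-⊔ (head v) (tail v) i

foldr-⊓≤lookup : ∀ {n} a (v : Vector ℕ n) i → foldr ℕ._⊓_ a v ℕ.≤ v i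
foldr-⊓≤lookup a v zero    = ℕ.m⊓n≤m _ _
foldr-⊓≤lookup a v (suc i) = ℕ.≤-trans (ℕ.m⊓n≤n _ _) (foldr-⊓≤lookup a (tail v) i)

foldr-⊓≤base : ∀ {n} a (v : Vector ℕ n) → foldr ℕ._⊓_ a v ℕ.≤ a
foldr-⊓≤base {zero}  a v = ℕ.≤-refl
foldr-⊓≤base {suc n} a v = ℕ.≤-trans (ℕ.m⊓n≤n _ _) (foldr-⊓≤base a (tail v))

minimum≤lookup : ∀ {n} (v : Vector ℕ (suc n)) i → minimum v ℕ.≤ v i
minimum≤lookup v zero    = foldr-⊓≤base (head v) (tail v)
minimum≤lookup v (suc i) = foldr-⊓≤lookup (head v) (tail v) i

-- Entry bounds from the margins and the minor relation.

module MarginBounds {c ℓ₁ ℓ₂} (ℝ : CompleteOrderedField c ℓ₁ ℓ₂) where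
  open OrderedField ℝ
  open FiniteSums ℝ

  sum≤⇒∃≤ : ∀ {n} {u v : Vector Carrier (suc n)} → sum u ≤ sum v → ∃[ i ] u i ≤ v i
  sum≤⇒∃≤ {zero}  h = zero , ≤-resp (+-identityʳ _) (+-identityʳ _) h
  sum≤⇒∃≤ {suc n} {u} {v} h with u zero ≤? v zero
  ... | yes u₀≤v₀ = zero , u₀≤v₀
  ... | no  u₀≰v₀ =
    let i , uᵢ≤vᵢ = sum≤⇒∃≤ {u = tail u} {v = tail v} (≤-by (+-nonNeg (x≤y⇒0≤y-x h) (x≤y⇒0≤y-x (<⇒≤ (≰⇒> u₀≰v₀))))
                      (solve 4 (λ a b c d → d :- c := b :+ d :- (a :+ c) :+ (a :- b)) refl (u zero) (v zero) (sum (tail u)) (sum (tail v))))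
    in suc i , uᵢ≤vᵢ

  sum-const : ∀ n x → sum {n} (λ _ → x) ≈ fromℕ n * x
  sum-const zero    x = sym (zeroˡ x)
  sum-const (suc n) x = trans (+-congˡ (sum-const n x)) (solve 2 (λ x N → x :+ N :* x := (:1 :+ N) :* x) refl x (fromℕ n))

  -- The constant vector `sum u` and the multiple of `u` by its length have equal sums, so no
  -- division is involved.
  ∃-above-average : ∀ {n} (u : Vector Carrier (suc n)) → ∃[ i ] sum u ≤ fromℕ (suc n) * u i
  ∃-above-average {n} u = sum≤⇒∃≤ (≤-reflexive (trans (sum-const (suc n) (sum u)) (*-distribˡ-sum (fromℕ (suc n)) u)))

  ∃-below-average : ∀ {n} (u : Vector Carrier (suc n)) → ∃[ i ] fromℕ (suc n) * u i ≤ sum u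
  ∃-below-average {n} u = sum≤⇒∃≤ (≤-reflexive (sym (trans (sum-const (suc n) (sum u)) (*-distribˡ-sum (fromℕ (suc n)) u))))

  ∃-argmin : ∀ {n} (u : Vector Carrier (suc n)) → ∃[ i ] ∀ j → u i ≤ u j
  ∃-argmin {zero}  u = zero , λ { zero → ≤-refl }
  ∃-argmin {suc n} u with ∃-argmin (tail u)
  ... | i , h with ≤-total (u zero) (u (suc i))
  ...   | inj₁ u₀≤uᵢ = zero , λ { zero → ≤-refl ; (suc j) → ≤-trans u₀≤uᵢ (h j) }
  ...   | inj₂ uᵢ≤u₀ = suc i , λ { zero → uᵢ≤u₀ ; (suc j) → h j }

  -- Matrix and margins are abstract here so that the same bounds apply to the transposed table.
  module _ {m′ n′} {X : Matrix ℝ (suc m′) (suc n′)}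
           {r : Vector Carrier (suc m′)} {r₋ r₊} (0<r : ∀ i → 0# < r i) (0≤r₋ : 0# ≤ r₋) (r₋≤r : ∀ i → r₋ ≤ r i) (r≤r₊ : ∀ i → r i ≤ r₊)
           {c : Vector Carrier (suc n′)} {c₋ c₊} (0<c : ∀ j → 0# < c j) (c₋≤c : ∀ j → c₋ ≤ c j) (c≤c₊ : ∀ j → c j ≤ c₊)
           (nonNegative : ∀ i j → 0# ≤ X i j) (rowSums : ∀ i → sum (X i) ≈ r i) (columnSums : ∀ j → sum (λ i → X i j) ≈ c j)
           (cross-ratio : ∀ i k j l → (X i j + 1#) * (X k l + 1#) * (X i l * X k j)
                                    ≤ (X i l + 1#) * (X k j + 1#) * (X i j * X k l)) where

    private
      m = fromℕ (suc m′)

    0<m : 0# < m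
    0<m = fromℕ-pos {suc m′} ℕ.z<s

    0<r₊ : 0# < r₊
    0<r₊ = <-≤-trans (0<r zero) (r≤r₊ zero)

    0≤c₊ : 0# ≤ c₊
    0≤c₊ = <⇒≤ (<-≤-trans (0<c zero) (c≤c₊ zero))

    -- If x_ij = 0, choose x_il > 0 and x_kj > 0 and apply the cross-ratio bound.
    entry-pos : ∀ i j → 0# < X i j
    entry-pos i j = ≰⇒> λ Xij≤0 →
      let l , above-row = ∃-above-average (X i)
          k , above-col = ∃-above-average (λ k → X k j)
          0<Xil = *-cancel-pos (fromℕ-nonNeg (suc n′)) (<-≤-trans (<-resp refl (sym (rowSums i)) (0<r i)) above-row)
          0<Xkj = *-cancel-pos (fromℕ-nonNeg (suc m′)) (<-≤-trans (<-resp refl (sym (columnSums j)) (0<c j)) above-col)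
      in <⇒≱ (*-pos (*-pos (+-nonNeg-pos (nonNegative i j) 0<1) (+-nonNeg-pos (nonNegative k l) 0<1)) (*-pos 0<Xil 0<Xkj))
           (≤-trans (cross-ratio i k j l) (≤-reflexive
             (trans (*-congˡ (trans (*-congʳ (antisym Xij≤0 (nonNegative i j))) (zeroˡ _))) (zeroʳ _))))

    -- Row k scaled by r_i and row i scaled by r_k have the same sum, so some column compares the
    -- right way; the scalars are then weakened to `r₋` and `r₊`.
    ratio-at-least-average : ∀ i k → ∃[ l ] r₋ * X k l ≤ r₊ * X i l
    ratio-at-least-average i k =
      let l , h = sum≤⇒∃≤ {u = λ l → r i * X k l} {v = λ l → r k * X i l} (≤-reflexive (begin-equality
            sum (λ l → r i * X k l)   ≈⟨ *-distribˡ-sum (r i) (X k) ⟨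
            r i * sum (X k)           ≈⟨ *-congˡ (rowSums k) ⟩
            r i * r k                 ≈⟨ *-comm _ _ ⟩
            r k * r i                 ≈⟨ *-congˡ (rowSums i) ⟨
            r k * sum (X i)           ≈⟨ *-distribˡ-sum (r k) (X i) ⟩
            sum (λ l → r k * X i l)   ∎))
      in l , (begin
        r₋ * X k l    ≤⟨ *-monoʳ-≤ (nonNegative k l) (r₋≤r i) ⟩
        r i * X k l   ≤⟨ h ⟩
        r k * X i l   ≤⟨ *-monoʳ-≤ (nonNegative i l) (r≤r₊ k) ⟩
        r₊ * X i l    ∎)

    -- For fixed rows, x_ij / x_kj is largest where x_ij is smallest.
    ratio-at-minimum : ∀ {a b c d} → 0# < a → 0# < b → 0# < c → 0# < d → a ≤ b → a ≤ c →
      (a + 1#) * (d + 1#) * (c * b) ≤ (c + 1#) * (b + 1#) * (a * d) → b * c ≤ a * d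
    ratio-at-minimum {a} {b} {c} {d} 0<a 0<b 0<c 0<d a≤b a≤c h = *-cancelˡ-≤ 0<coefficient (≤-by
      (+-nonNeg (*-nonNeg (<⇒≤ 0<a) (x≤y⇒0≤y-x h))
                (*-nonNeg (*-nonNeg (<⇒≤ 0<b) (<⇒≤ 0<c)) (*-nonNeg (x≤y⇒0≤y-x a≤b) (x≤y⇒0≤y-x a≤c))))
      (solve 4 (λ a b c d →
          (a :* b :+ a :* c :+ a :- b :* c) :* (a :* d) :- (a :* b :+ a :* c :+ a :- b :* c) :* (b :* c)
          := a :* ((c :+ :1) :* (b :+ :1) :* (a :* d) :- (a :+ :1) :* (d :+ :1) :* (c :* b)) :+ b :* c :* ((b :- a) :* (c :- a)))
        refl a b c d))
      where
      -- The factor is the coefficient of `d` when `h` is solved for `d`; it is positive because `h`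
      -- bounds its product with `d` below by (a + 1) b c.
      0<coefficient : 0# < a * b + a * c + a - b * c
      0<coefficient = *-cancel-pos (<⇒≤ 0<d) (<-≤-trans
        (*-pos (+-nonNeg-pos (<⇒≤ 0<a) 0<1) (*-pos 0<b 0<c))
        (≤-by (x≤y⇒0≤y-x h) (solve 4 (λ a b c d →
            d :* (a :* b :+ a :* c :+ a :- b :* c) :- (a :+ :1) :* (b :* c)
            := (c :+ :1) :* (b :+ :1) :* (a :* d) :- (a :+ :1) :* (d :+ :1) :* (c :* b)) refl a b c d)))

    -- If x_kj ≤ x_ij, then r₋ ≤ r₊ suffices. Otherwise the ratio of the rows in column j is at
    -- least the one in the column `l` supplied by `ratio-at-least-average`.
    ratio-at-row-minimum : ∀ {i j} → (∀ l → X i j ≤ X i l) → ∀ k → r₋ * X k j ≤ r₊ * X i j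
    ratio-at-row-minimum {i} {j} minimal k = compare (≤-total (X i j) (X k j)) (ratio-at-least-average i k)
      where
      compare : X i j ≤ X k j ⊎ X k j ≤ X i j → ∃[ l ] r₋ * X k l ≤ r₊ * X i l → r₋ * X k j ≤ r₊ * X i j
      compare (inj₂ b≤a) _              = *-mono-≤ (nonNegative k j) (<⇒≤ 0<r₊) (≤-trans (r₋≤r k) (r≤r₊ k)) b≤a
      compare (inj₁ a≤b) (l , r₋v≤r₊u) = *-cancelˡ-≤ (entry-pos k l) (begin
        v * (r₋ * b)    ≈⟨ solve 3 (λ v r b → v :* (r :* b) := b :* (r :* v)) refl v r₋ b ⟩
        b * (r₋ * v)    ≤⟨ *-monoˡ-≤ (nonNegative k j) r₋v≤r₊u ⟩
        b * (r₊ * u)    ≈⟨ solve 3 (λ u r b → b :* (r :* u) := r :* (b :* u)) refl u r₊ b ⟩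
        r₊ * (b * u)    ≤⟨ *-monoˡ-≤ (<⇒≤ 0<r₊) (ratio-at-minimum (entry-pos i j) (entry-pos k j) (entry-pos i l) (entry-pos k l)
                             a≤b (minimal l) (cross-ratio i k j l)) ⟩
        r₊ * (a * v)    ≈⟨ solve 3 (λ a r v → r :* (a :* v) := v :* (r :* a)) refl a r₊ v ⟩
        v * (r₊ * a)    ∎)
        where
        a = X i j
        b = X k j
        u = X i l
        v = X k l

    lower-bound-product : ∀ i j → r₋ * c₋ ≤ r₊ * m * X i j
    lower-bound-product i j =
      let j₀ , minimal = ∃-argmin (X i)
          k , above-average = ∃-above-average (λ k → X k j₀)
      in begin
        r₋ * c₋                ≤⟨ *-monoˡ-≤ 0≤r₋ (c₋≤c j₀) ⟩
        r₋ * c j₀              ≤⟨ *-monoˡ-≤ 0≤r₋ (≤-resp (columnSums j₀) refl above-average) ⟩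
        r₋ * (m * X k j₀)      ≈⟨ solve 3 (λ r m x → r :* (m :* x) := m :* (r :* x)) refl r₋ m (X k j₀) ⟩
        m * (r₋ * X k j₀)      ≤⟨ *-monoˡ-≤ (<⇒≤ 0<m) (ratio-at-row-minimum minimal k) ⟩
        m * (r₊ * X i j₀)      ≈⟨ solve 3 (λ r m x → m :* (r :* x) := r :* m :* x) refl r₊ m (X i j₀) ⟩
        r₊ * m * X i j₀        ≤⟨ *-monoˡ-≤ (*-nonNeg (<⇒≤ 0<r₊) (<⇒≤ 0<m)) (minimal j) ⟩
        r₊ * m * X i j         ∎

    lower-bound : ∀ i j → (r₋ * c₋) / (r₊ * m) ≤ X i j
    lower-bound i j = x/y≤z (*-pos 0<r₊ 0<m) (lower-bound-product i j)

    -- For positive values the hypotheses read u_t u_p ≤ u_y u_q and u_p / u_q ≥ (r₊ q + r₋) / (r₊ q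
    -- + r₊). Together they bound u_y below; the conclusion is that bound with denominators cleared.
    solve-for-maximum : ∀ {y t p q} → 0# < p → 0# ≤ y →
      (t + 1#) * (p + 1#) * (y * q) ≤ (y + 1#) * (q + 1#) * (t * p) →
      0# ≤ t → r₋ * p ≤ r₊ * q →
      y * (r₋ + r₊ * q) ≤ t * (r₊ * q + r₊ + y * (r₊ - r₋))
    solve-for-maximum {y} {t} {p} {q} 0<p 0≤y h 0≤t r₋p≤r₊q = *-cancelˡ-≤ 0<p (≤-by
      (+-nonNeg (*-nonNeg (<⇒≤ 0<r₊) (x≤y⇒0≤y-x h))
                (*-nonNeg (*-nonNeg 0≤y (+-nonNeg 0≤t 0≤1)) (x≤y⇒0≤y-x r₋p≤r₊q)))
      (solve 6 (λ y t p q r s →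
          p :* (t :* (s :* q :+ s :+ y :* (s :- r))) :- p :* (y :* (r :+ s :* q))
          := s :* ((y :+ :1) :* (q :+ :1) :* (t :* p) :- (t :+ :1) :* (p :+ :1) :* (y :* q)) :+ y :* (t :+ :1) :* (s :* q :- r :* p))
        refl y t p q r₋ r₊))

    denominator : Carrier
    denominator = r₋ * c₊ + r₋ * c₋ + m * r₋ - r₊ * c₊

    -- Inserting m t ≤ c₊ into `solve-for-maximum` leaves `q` with coefficient r₊ (m y - c₊). If m y
    -- ≥ c₊, replacing `q` by its lower bound is legitimate, and `denominator` is then the
    -- coefficient of `y`. If m y ≤ c₊, comparing `denominator` with r₋ c₋ + m r₊ is enough.
    upper-bound-product : 0# < denominator → ∀ k l → m * denominator * X k l ≤ c₊ * (r₋ * c₋ + m * r₊)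
    upper-bound-product 0<D k l =
      let i , below-average = ∃-below-average (λ i → X i l)
          j , r₋p≤r₊q = ratio-at-least-average i k
      in compare (≤-total (m * X k l) c₊)
           (≤-trans (≤-resp refl (columnSums l) below-average) (c≤c₊ l))
           (solve-for-maximum (entry-pos k j) (nonNegative k l)
             (≤-resp (*-congˡ (*-comm _ _)) (*-congʳ (*-comm _ _)) (cross-ratio i k l j)) (nonNegative i l) r₋p≤r₊q)
           (nonNegative i j) (lower-bound-product i j)
      where
      r₋≤r₊ : r₋ ≤ r₊
      r₋≤r₊ = ≤-trans (r₋≤r k) (r≤r₊ k)

      denominator≤ : denominator ≤ r₋ * c₋ + m * r₊
      denominator≤ = ≤-by (*-nonNeg (+-nonNeg 0≤c₊ (<⇒≤ 0<m)) (x≤y⇒0≤y-x r₋≤r₊))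
        (solve 5 (λ r s γ κ m → r :* κ :+ m :* s :- (r :* γ :+ r :* κ :+ m :* r :- s :* γ) := (γ :+ m) :* (s :- r)) refl r₋ r₊ c₊ c₋ m)

      compare : ∀ {y t q} → m * y ≤ c₊ ⊎ c₊ ≤ m * y → m * t ≤ c₊ →
        y * (r₋ + r₊ * q) ≤ t * (r₊ * q + r₊ + y * (r₊ - r₋)) → 0# ≤ q → r₋ * c₋ ≤ r₊ * m * q →
        m * denominator * y ≤ c₊ * (r₋ * c₋ + m * r₊)
      compare {y} (inj₁ my≤c₊) _ _ _ _ = begin
        m * denominator * y         ≈⟨ solve 3 (λ m D y → m :* D :* y := m :* y :* D) refl m denominator y ⟩
        m * y * denominator         ≤⟨ *-mono-≤ (<⇒≤ 0<D) 0≤c₊ my≤c₊ denominator≤ ⟩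
        c₊ * (r₋ * c₋ + m * r₊)     ∎
      compare {y} {t} {q} (inj₂ c₊≤my) mt≤c₊ solved 0≤q r₋c₋≤r₊mq = ≤-by
        (+-nonNeg
          (*-nonNeg (<⇒≤ 0<m) (+-nonNeg (*-nonNeg (<⇒≤ 0<m) (x≤y⇒0≤y-x solved)) (*-nonNeg (x≤y⇒0≤y-x mt≤c₊)
            (+-nonNeg (+-nonNeg (*-nonNeg (<⇒≤ 0<r₊) 0≤q) (<⇒≤ 0<r₊)) (*-nonNeg 0≤y (x≤y⇒0≤y-x r₋≤r₊))))))
          (*-nonNeg (x≤y⇒0≤y-x c₊≤my) (x≤y⇒0≤y-x r₋c₋≤r₊mq)))
        (solve 8 (λ y t q r s γ κ m →
            γ :* (r :* κ :+ m :* s) :- m :* (r :* γ :+ r :* κ :+ m :* r :- s :* γ) :* y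
            := m :* (m :* (t :* (s :* q :+ s :+ y :* (s :- r)) :- y :* (r :+ s :* q)) :+ (γ :- m :* t) :* (s :* q :+ s :+ y :* (s :- r)))
               :+ (m :* y :- γ) :* (s :* m :* q :- r :* κ))
          refl y t q r₋ r₊ c₊ c₋ m)
        where
        0≤y = *-cancel-nonNeg 0<m (≤-trans 0≤c₊ c₊≤my)

    upper-bound : r₊ * c₊ < r₋ * c₊ + r₋ * c₋ + m * r₋ →
      ∀ k l → X k l ≤ (c₊ * (r₋ * c₋ + m * r₊)) / (m * (r₋ * c₊ + r₋ * c₋ + m * r₋ - r₊ * c₊))
    upper-bound h k l = z≤x/y (*-pos 0<m 0<D) (upper-bound-product 0<D k l)
      where 0<D = x<y⇒0<y-x h

theorem3p5 : ∀ {c ℓ₁ ℓ₂} (ℝ : CompleteOrderedField c ℓ₁ ℓ₂) (log : NaturalLogarithm ℝ)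
      (m′ n′ : ℕ) (R : Vector ℕ (suc m′)) (C : Vector ℕ (suc n′)) →
    (∀ i → 0 ℕ.< R i) → (∀ j → 0 ℕ.< C j) → total R ≡ total C →
    (X : Matrix ℝ (suc m′) (suc n′)) → IsTypicalTable ℝ log R C X →
    let open CompleteOrderedField ℝ
        m  = fromℕ (suc m′)
        n  = fromℕ (suc n′)
        r₊ = fromℕ (maximum R)
        r₋ = fromℕ (minimum R)
        c₊ = fromℕ (maximum C)
        c₋ = fromℕ (minimum C)
    in
    (∀ i j → ((r₋ * c₋) / (r₊ * m) ≤ X i j) × ((c₋ * r₋) / (c₊ * n) ≤ X i j))
    ×
    (r₊ * c₊ < r₋ * c₊ + r₋ * c₋ + m * r₋ →
      ∀ i j → X i j ≤ (c₊ * (r₋ * c₋ + m * r₊))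
                      / (m * (r₋ * c₊ + r₋ * c₋ + m * r₋ - r₊ * c₊)))
    ×
    (r₊ * c₊ < c₋ * r₊ + c₋ * r₋ + n * c₋ →
      ∀ i j → X i j ≤ (r₊ * (c₋ * r₋ + n * c₊))
                      / (n * (c₋ * r₊ + c₋ * r₋ + n * c₋ - c₊ * r₊)))
theorem3p5 ℝ log m′ n′ R C 0<R 0<C _ X X* =
  (λ i j → lower-bound r-pos 0≤r₋ r₋≤r r≤r₊ c-pos c₋≤c c≤c₊ nonNegative rowSums columnSums cross i j ,
           -- The bounds with `n` in the denominator are those of the transposed table, hence the
           -- exchanged margins and indices.
           lower-bound c-pos 0≤c₋ c₋≤c c≤c₊ r-pos r₋≤r r≤r₊ (flip nonNegative) columnSums rowSums crossᵀ j i) ,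
  upper-bound r-pos 0≤r₋ r₋≤r r≤r₊ c-pos c₋≤c c≤c₊ nonNegative rowSums columnSums cross ,
  (λ h i j → upper-bound c-pos 0≤c₋ c₋≤c c≤c₊ r-pos r₋≤r r≤r₊ (flip nonNegative) columnSums rowSums crossᵀ
    (<-resp (*-comm _ _) refl h) j i)
  where
  open OrderedField ℝ
  open MarginBounds ℝ
  open IsTypicalTable X*
  open TransportationPolytope feasible

  r-pos = λ i → fromℕ-pos (0<R i)
  c-pos = λ j → fromℕ-pos (0<C j)
  r₋≤r = λ i → fromℕ-mono (minimum≤lookup R i)
  r≤r₊ = λ i → fromℕ-mono (lookup≤maximum R i)
  c₋≤c = λ j → fromℕ-mono (minimum≤lookup C j)
  c≤c₊ = λ j → fromℕ-mono (lookup≤maximum C j)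
  0≤r₋ = fromℕ-nonNeg (minimum R)
  0≤c₋ = fromℕ-nonNeg (minimum C)

  cross = Optimality.cross-ratio ℝ log X*

  -- Transposition maps the minor relation to itself up to the order of the factors.
  crossᵀ : ∀ j l i k → (X i j + 1#) * (X k l + 1#) * (X k j * X i l) ≤ (X k j + 1#) * (X i l + 1#) * (X i j * X k l)
  crossᵀ j l i k = ≤-resp (*-congˡ (*-comm _ _)) (*-congʳ (*-comm _ _)) (cross i k j l)
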